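{- Let $\delta\geq 1$, $k\geq 0$ be integers, $h=k+1$, and let $n$ and $m$ be integers (with $n\geq 1$) with $d=2m/n\geq\delta$, $x=(d-\delta)/h$ and $$n\ \geq\ \max\left\{\frac{(2d+5h+1)^2}{4\delta},\ (2x+3)^2\right\}.$$ Then $$\min\{\mathrm{sp}(G,k):G\text{ a graph of order }n\text{ with }m\text{ edges and }\delta(G)=\delta\}\ =\ \max_{t\geq 1}\left\lceil f_t(n,m,\delta,k)\right\rceil ,$$ where the maximum is over integers $t\geq 1$.
   Context: Graphs are finite and simple; $\delta(G)$ is the minimum degree of $G$. For a graph $G$ and $B\subseteq V(G)$ the spread is $\mathrm{sp}(B)=\max_{u\in B}\deg_G(u)-\min_{v\in B}\deg_G(v)$, and $\mathrm{sp}(G,k)$ is the largest cardinality of a set $B\subseteq V(G)$ with $\mathrm{sp}(B)\leq k$. Further, $$f_t(n,m,\delta,k)=\frac{2\left(n(\delta+t(k+1))-2m\right)}{(k+1)\,t(t+1)}.$$ -}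

module Defs where

open import Data.Bool using (Bool; false; T?)
open import Data.Fin using (Fin; _<?_)
open import Data.Fin.Subset using (Subset; inside; outside; ⊤; ∣_∣)
open import Data.Fin.Subset.Properties using (_∈?_)
open import Data.Integer as ℤ using (ℤ; +_)
open import Data.List using (List; []; _∷_; [_]; _++_; map; filter; length; allFin; cartesianProduct)
open import Data.List.Extrema.Nat using (max; min)
open import Data.Nat using (ℕ; zero; suc; NonZero; _*_; _∸_; _≤?_)
open import Data.Nat.Properties using (m*n≢0)
open import Data.Product using (_×_; _,_)
open import Data.Rational as ℚ using (ℚ)
open import Data.Vec using (tabulate; []; _∷_)
open import Level using (Level; _⊔_)
open import Relation.Binary using (Rel)
open import Relation.Binary.PropositionalEquality using (_≡_)
open import Relation.Nullary.Decidable using (_×-dec_)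
open import Relation.Unary using (Pred)

private
  variable
    a p ℓ : Level
    n     : ℕ

IsLeast : {A : Set a} → Rel A ℓ → Pred A p → A → Set (a ⊔ p ⊔ ℓ)
IsLeast _≤_ P x = P x × (∀ y → P y → x ≤ y)

IsGreatest : {A : Set a} → Rel A ℓ → Pred A p → A → Set (a ⊔ p ⊔ ℓ)
IsGreatest _≤_ P x = P x × (∀ y → P y → y ≤ x)

record Graph (n : ℕ) : Set where
  field
    adj    : Fin n → Fin n → Bool
    sym    : ∀ u v → adj u v ≡ adj v u
    irrefl : ∀ v → adj v v ≡ false

open Graph public

neighbours : Graph n → Fin n → Subset n
neighbours G v = tabulate (adj G v)

degree : Graph n → Fin n → ℕ
degree G v = ∣ neighbours G v ∣

-- Each edge is listed once, with its smaller endpoint first.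
edges : Graph n → List (Fin n × Fin n)
edges {n} G =
  filter (λ (u , v) → (u <? v) ×-dec T? (adj G u v)) (cartesianProduct (allFin n) (allFin n))

edgeCount : Graph n → ℕ
edgeCount G = length (edges G)

degreesOn : Graph n → Subset n → List ℕ
degreesOn {n} G B = map (degree G) (filter (_∈? B) (allFin n))

-- The defaults 0 and n below are neutral: every degree lies between 0 and n,
-- so they are returned only if B is empty or happen to be the true extremum.
maxDegreeOn : Graph n → Subset n → ℕ
maxDegreeOn G B = max 0 (degreesOn G B)

minDegreeOn : Graph n → Subset n → ℕ
minDegreeOn {n} G B = min n (degreesOn G B)

minDegree : Graph n → ℕ
minDegree G = minDegreeOn G ⊤

-- The empty set gets spread 0; having cardinality 0, it does not affect sp.
spread : Graph n → Subset n → ℕ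
spread G B = maxDegreeOn G B ∸ minDegreeOn G B

subsets : ∀ n → List (Subset n)
subsets zero    = [ [] ]
subsets (suc n) = map (inside ∷_) (subsets n) ++ map (outside ∷_) (subsets n)

sp : Graph n → ℕ → ℕ
sp {n} G k = max 0 (map ∣_∣ (filter (λ B → spread G B ≤? k) (subsets n)))

f : (t n m δ k : ℕ) .{{_ : NonZero t}} → ℚ
f t n m δ k =
  (+ 2 ℤ.* (+ n ℤ.* (+ δ ℤ.+ + t ℤ.* + suc k) ℤ.- + 2 ℤ.* + m) ℚ./ (suc k * (t * suc t)))
    {{m*n≢0 (suc k) (t * suc t) {{_}} {{m*n≢0 t (suc t)}}}}

fromℕ : ℕ → ℚ
fromℕ i = + i ℚ./ 1

infixl 7 _/ℕ_

_/ℕ_ : ℚ → (i : ℕ) → .{{NonZero i}} → ℚ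
q /ℕ i = q ℚ.* (+ 1 ℚ./ i)

square : ℚ → ℚ
square q = q ℚ.* q

{-# OPTIONS --safe #-}

-- Lower bound: if every window of k + 1 consecutive degrees holds at most s vertices, then at most i s
-- vertices have degree below δ + i h, and summing over i ≤ t gives n (δ + t h) ≤ 2 m + h s t (t + 1) / 2,
-- that is f_t ≤ s.
--
-- Upper bound: let N = 2 m − δ n, and let s be least with h Σ_{p<n} ⌊p/s⌋ ≤ N.  The degrees δ + h ⌊p/s⌋ leave a
-- rest E = N − h Σ ⌊p/s⌋ to be added to the largest ones; n ≥ (2x+3)² makes E at most 2h (n − 1), so
-- increments of at most 2h suffice, and p and p + s still differ by at least h.  As s − 1 violates the
-- inequality, f_t > s − 1 for t = ⌊n/(s − 1)⌋.
--
-- All degrees lie between δ and an A with (A + δ + 1)² ≤ 4 δ n, so by Zverovich and Zverovich they are those of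
-- a graph.  For this, take the threshold graph with m edges made of δ dominating vertices and a clique on the
-- first p vertices, and move edges from vertices of larger to vertices of smaller degree.

module Submission where

-- Every ceiling of `f_t` is at most `sp` of every admissible graph. One graph and one `t` with
-- equal values therefore settle both extrema, including the existence of a maximum over infinitely
-- many `t`. The constants come from `q = ⌊n/s⌋`. The levels `⌊p/s⌋` average at least `(q − 1)/2`,
-- and since they fit into `N = x h n` they average at most `x`; hence `q ≤ 2x + 1`. So
-- `(q + 2)² ≤ n`, which forces `q < 2(s − 1)`, and replacing `s` by `s − 1` raises a level by at
-- most 2: this is the factor in `2h`. The largest degree is at most `A = δ + h q + 2h`, so
-- `A + δ + 1 ≤ 2d + 3h + 1`. The minimum degree has to be exactly `δ`, so one vertex must receive
-- no increment. There is room for this because the level at `p = 0` does not rise, whence `n − 1`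
-- instead of `n` in the bound on `E`. The obstacle to realising a sequence is that an edge end can
-- be moved from `u` to `v` only if `u` has the larger degree. A threshold graph is uneven enough
-- for such a pair to exist until the target is reached.

module Combinatorics where

  open import Defs hiding (sym)
  open import Data.Bool using (T?; Bool; true; false; if_then_else_; _∧_)
  import Data.Bool.Properties as Bool
  open import Data.Fin as Fin using (Fin; zero; suc; toℕ)
  open import Data.Fin.Permutation using (transpose)
  import Data.Fin.Permutation.Components as PC
  import Data.Fin.Properties as Fin
  open import Data.Fin.Subset as Subset using (Subset; ∣_∣; inside; outside)
  import Data.Fin.Subset.Properties as Subset
  open import Data.List as List using (List; []; _∷_)
  open import Data.List.Extrema.Nat using (max≤v⁺; xs≤max; v≤min⁺; min≤xs; min≈v⁺)
  import Data.List.Membership.Propositional as List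
  import Data.List.Membership.Propositional.Properties as List
  import Data.List.Properties as List
  open import Data.List.Relation.Unary.All as All using (All)
  open import Data.List.Relation.Unary.Any using (here; there)
  open import Data.Nat
  open import Data.Nat.DivMod
  open import Data.Nat.Properties
  open import Algebra.Properties.CommutativeMonoid.Sum +-0-commutativeMonoid
    using (sum; ∑-distrib-+; ∑-comm; sum-permute; sum-cong-≗)
  open import Data.Nat.Solver using (module +-*-Solver)
  open import Data.Product using (Σ; ∃; _×_; _,_; proj₁; proj₂; uncurry)
  open import Data.Sum using (_⊎_; inj₁; inj₂; [_,_]′)
  import Data.Vec as Vec
  import Data.Vec.Properties as Vec
  open import Function using (_∘_; id; case_of_)
  open import Level using (0ℓ)
  open import Relation.Binary.Definitions using (tri<; tri≈; tri>)
  open import Relation.Binary.PropositionalEquality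
  open import Relation.Nullary using (¬_; Dec; yes; no; does; contradiction)
  open import Relation.Nullary.Decidable using (dec-true; dec-false; _×-dec_; _⊎-dec_; ¬?)
  open import Relation.Unary using (Pred; Decidable)

  private
    variable
      n : ℕ

  -- Finite sums

  sum-mono-≤ : {f g : Fin n → ℕ} → (∀ i → f i ≤ g i) → sum f ≤ sum g
  sum-mono-≤ {zero}  f≤g = z≤n
  sum-mono-≤ {suc n} f≤g = +-mono-≤ (f≤g zero) (sum-mono-≤ (f≤g ∘ suc))

  sum-mono-< : {f g : Fin n → ℕ} → (∀ i → f i ≤ g i) → ∀ j → f j < g j → sum f < sum g
  sum-mono-< f≤g zero    fj<gj = +-mono-<-≤ fj<gj (sum-mono-≤ (f≤g ∘ suc))
  sum-mono-< f≤g (suc j) fj<gj = +-mono-≤-< (f≤g zero) (sum-mono-< (f≤g ∘ suc) j fj<gj)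

  sum-≡⇒≗ : {f g : Fin n → ℕ} → (∀ i → f i ≤ g i) → sum f ≡ sum g → ∀ i → f i ≡ g i
  sum-≡⇒≗ f≤g eq i = case m≤n⇒m<n∨m≡n (f≤g i) of λ where
    (inj₁ fi<gi) → contradiction eq (<⇒≢ (sum-mono-< f≤g i fi<gi))
    (inj₂ fi≡gi) → fi≡gi

  sum-const : ∀ n c → sum {n} (λ _ → c) ≡ n * c
  sum-const zero    c = refl
  sum-const (suc n) c = cong (c +_) (sum-const n c)

  *-distribˡ-sum : ∀ c (f : Fin n → ℕ) → c * sum f ≡ sum (λ i → c * f i)
  *-distribˡ-sum {zero}  c f = *-zeroʳ c
  *-distribˡ-sum {suc n} c f =
    trans (*-distribˡ-+ c (f zero) _) (cong (c * f zero +_) (*-distribˡ-sum c (f ∘ suc)))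

  ind : Bool → ℕ
  ind true  = 1
  ind false = 0

  ind≤1 : ∀ b → ind b ≤ 1
  ind≤1 true  = ≤-refl
  ind≤1 false = z≤n

  ind-mono : ∀ {a b} → (a ≡ true → b ≡ true) → ind a ≤ ind b
  ind-mono {true}  {b} imp rewrite imp refl = ≤-refl
  ind-mono {false}     imp = z≤n

  -- With numerical indicators a unit transfer from `u` to `v` becomes the equation
  -- `g′ x + (x [≟] u) ≡ g x + (x [≟] v)`, in which no truncated subtraction occurs.
  _[≟]_ : Fin n → Fin n → ℕ
  i [≟] j = ind (does (i Fin.≟ j))

  _[<]_ : Fin n → ℕ → ℕ
  i [<] p = ind (does (toℕ i <? p))

  [≟]-refl : (i : Fin n) → i [≟] i ≡ 1
  [≟]-refl i = cong ind (dec-true (i Fin.≟ i) refl)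

  [≟]-≢ : {i j : Fin n} → i ≢ j → i [≟] j ≡ 0
  [≟]-≢ {i = i} {j} i≢j = cong ind (dec-false (i Fin.≟ j) i≢j)

  [<]-yes : {i : Fin n} {p : ℕ} → toℕ i < p → i [<] p ≡ 1
  [<]-yes {i = i} {p} lt = cong ind (dec-true (toℕ i <? p) lt)

  [<]-no : {i : Fin n} {p : ℕ} → ¬ toℕ i < p → i [<] p ≡ 0
  [<]-no {i = i} {p} nlt = cong ind (dec-false (toℕ i <? p) nlt)

  sum-[≟] : (c : Fin n → ℕ) (i : Fin n) → sum (λ j → c j * (j [≟] i)) ≡ c i
  sum-[≟] {suc n} c zero = begin
    c zero * 1 + sum (λ (j : Fin n) → c (suc j) * 0)
      ≡⟨ cong₂ _+_ (*-identityʳ (c zero)) (sum-cong-≗ (λ j → *-zeroʳ (c (suc j)))) ⟩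
    c zero + sum {n} (λ _ → 0)
      ≡⟨ cong (c zero +_) (trans (sum-const n 0) (*-zeroʳ n)) ⟩
    c zero + 0
      ≡⟨ +-identityʳ _ ⟩
    c zero ∎
    where open ≡-Reasoning
  sum-[≟] {suc n} c (suc i) = cong₂ _+_ (*-zeroʳ (c zero)) (sum-[≟] (c ∘ suc) i)

  sum-[≟]-1 : (i : Fin n) → sum (_[≟] i) ≡ 1
  sum-[≟]-1 i = trans (sum-cong-≗ (λ j → sym (*-identityˡ (j [≟] i)))) (sum-[≟] (λ _ → 1) i)

  sum-[<]≤ : ∀ p → sum {n} (_[<] p) ≤ p
  sum-[<]≤ {zero}  p       = z≤n
  sum-[<]≤ {suc n} zero    = ≤-reflexive (trans (sum-const n 0) (*-zeroʳ n))
  sum-[<]≤ {suc n} (suc p) = s≤s (sum-[<]≤ {n} p)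

  sum-[<] : ∀ {p} → p ≤ n → sum {n} (_[<] p) ≡ p
  sum-[<] {n}     z≤n       = trans (sum-const n 0) (*-zeroʳ n)
  sum-[<] {suc n} (s≤s p≤n) = cong suc (sum-[<] p≤n)

  sum-*-[<] : ∀ c {p} → p ≤ n → sum {n} (λ i → c * (i [<] p)) ≡ c * p
  sum-*-[<] {n} c {p} p≤n = trans (sym (*-distribˡ-sum {n} c (_[<] p))) (cong (c *_) (sum-[<] p≤n))

  -- How a linear functional changes under a unit transfer.
  sum-shift : (c : Fin n → ℕ) {f g : Fin n → ℕ} (i j : Fin n) →
              (∀ x → f x + (x [≟] i) ≡ g x + (x [≟] j)) →
              sum (λ x → c x * f x) + c i ≡ sum (λ x → c x * g x) + c j
  sum-shift c {f} {g} i j eq = begin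
    sum (λ x → c x * f x) + c i                             ≡⟨ expand f i ⟩
    sum (λ x → c x * (f x + (x [≟] i)))                     ≡⟨ sum-cong-≗ (λ x → cong (c x *_) (eq x)) ⟩
    sum (λ x → c x * (g x + (x [≟] j)))                     ≡⟨ expand g j ⟨
    sum (λ x → c x * g x) + c j                             ∎
    where
    open ≡-Reasoning
    expand : ∀ f i → sum (λ x → c x * f x) + c i ≡ sum (λ x → c x * (f x + (x [≟] i)))
    expand f i = begin
      sum (λ x → c x * f x) + c i                           ≡⟨ cong (_ +_) (sum-[≟] c i) ⟨
      sum (λ x → c x * f x) + sum (λ x → c x * (x [≟] i))   ≡⟨ ∑-distrib-+ (λ x → c x * f x) _ ⟨
      sum (λ x → c x * f x + c x * (x [≟] i))               ≡⟨ sum-cong-≗ (λ x → sym (*-distribˡ-+ (c x) (f x) _)) ⟩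
      sum (λ x → c x * (f x + (x [≟] i)))                   ∎

  -- Degrees and edges

  deg : Graph n → Fin n → ℕ
  deg G v = sum (λ w → ind (adj G v w))

  ∣tabulate∣ : (f : Fin n → Bool) → ∣ Vec.tabulate f ∣ ≡ sum (ind ∘ f)
  ∣tabulate∣ {zero}  f = refl
  ∣tabulate∣ {suc n} f with f zero
  ... | true  = cong suc (∣tabulate∣ (f ∘ suc))
  ... | false = ∣tabulate∣ (f ∘ suc)

  degree≡deg : (G : Graph n) (v : Fin n) → degree G v ≡ deg G v
  degree≡deg G v = ∣tabulate∣ (adj G v)

  module _ {A : Set} {P : Pred A 0ℓ} (P? : Decidable P) where

    length-filter-∷ : ∀ x xs → List.length (List.filter P? (x ∷ xs)) ≡ ind (does (P? x)) + List.length (List.filter P? xs)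
    length-filter-∷ x xs with does (P? x)
    ... | true  = refl
    ... | false = refl

    length-filter-map-tabulate : {B : Set} (e : B → A) (g : Fin n → B) →
      List.length (List.filter P? (List.map e (List.tabulate g))) ≡ sum (λ i → ind (does (P? (e (g i)))))
    length-filter-map-tabulate {zero}  e g = refl
    length-filter-map-tabulate {suc n} e g =
      trans (length-filter-∷ (e (g zero)) _) (cong (_ +_) (length-filter-map-tabulate e (g ∘ suc)))

  length-filter-cartesianProduct :
    ∀ {m} {B C : Set} {P : Pred (B × C) 0ℓ} (P? : Decidable P) (g : Fin m → B) (h : Fin n → C) →
    List.length (List.filter P? (List.cartesianProduct (List.tabulate g) (List.tabulate h)))
      ≡ sum (λ i → sum (λ j → ind (does (P? (g i , h j)))))
  length-filter-cartesianProduct {m = zero}  P? g h = refl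
  length-filter-cartesianProduct {m = suc m} P? g h = begin
    List.length (List.filter P? (row List.++ rest))
      ≡⟨ cong List.length (List.filter-++ P? row rest) ⟩
    List.length (List.filter P? row List.++ List.filter P? rest)
      ≡⟨ List.length-++ (List.filter P? row) ⟩
    List.length (List.filter P? row) + List.length (List.filter P? rest)
      ≡⟨ cong₂ _+_ (length-filter-map-tabulate P? (g zero ,_) h) (length-filter-cartesianProduct P? (g ∘ suc) h) ⟩
    _ ∎
    where
    open ≡-Reasoning
    row  = List.map (g zero ,_) (List.tabulate h)
    rest = List.cartesianProduct (List.tabulate (g ∘ suc)) (List.tabulate h)

  edgeCount≡sum : (G : Graph n) →
    edgeCount G ≡ sum (λ u → sum (λ v → ind (does (u Fin.<? v) ∧ adj G u v)))
  edgeCount≡sum G = length-filter-cartesianProduct (λ (u , v) → (u Fin.<? v) ×-dec T? (adj G u v)) id id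

  -- An ordered adjacent pair is increasing or decreasing, and exchanging the two sums turns the
  -- decreasing pairs into increasing ones.
  handshake : (G : Graph n) → sum (deg G) ≡ edgeCount G + edgeCount G
  handshake {n} G = begin
    sum (λ u → sum (λ v → ind (adj G u v)))
      ≡⟨ sum-cong-≗ (λ u → sum-cong-≗ (λ v → split u v)) ⟩
    sum (λ u → sum (λ v → e u v + e v u))
      ≡⟨ sum-cong-≗ (λ u → ∑-distrib-+ (e u) (λ v → e v u)) ⟩
    sum (λ u → sum (e u) + sum (λ v → e v u))
      ≡⟨ ∑-distrib-+ (λ u → sum (e u)) _ ⟩
    sum (λ u → sum (e u)) + sum (λ u → sum (λ v → e v u))
      ≡⟨ cong (sum (λ u → sum (e u)) +_) (∑-comm (λ u v → e v u)) ⟩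
    sum (λ u → sum (e u)) + sum (λ u → sum (e u))
      ≡⟨ cong₂ _+_ (edgeCount≡sum G) (edgeCount≡sum G) ⟨
    edgeCount G + edgeCount G ∎
    where
    open ≡-Reasoning
    e : Fin n → Fin n → ℕ
    e u v = ind (does (u Fin.<? v) ∧ adj G u v)
    split : ∀ u v → ind (adj G u v) ≡ e u v + e v u
    split u v with Fin.<-cmp u v
    ... | tri< u<v _ v≮u rewrite dec-true (u Fin.<? v) u<v | dec-false (v Fin.<? u) v≮u = sym (+-identityʳ _)
    ... | tri≈ u≮v refl v≮u rewrite dec-false (u Fin.<? v) u≮v = cong ind (irrefl G u)
    ... | tri> u≮v _ v<u rewrite dec-false (u Fin.<? v) u≮v | dec-true (v Fin.<? u) v<u = cong ind (Graph.sym G u v)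

  -- Unit transfers of degree

  sum-differ : (w : Fin n) {f g : Fin n → ℕ} → (∀ x → x ≢ w → f x ≡ g x) → sum f + g w ≡ sum g + f w
  sum-differ {suc n} zero {f} {g} eq = begin
    f zero + sum (f ∘ suc) + g zero   ≡⟨ cong (λ z → f zero + z + g zero) (sum-cong-≗ (λ i → eq (suc i) λ ())) ⟩
    f zero + sum (g ∘ suc) + g zero   ≡⟨ solve 3 (λ a b c → a :+ b :+ c
          := c :+ b :+ a) refl (f zero) _ (g zero) ⟩
    g zero + sum (g ∘ suc) + f zero   ∎
    where
    open ≡-Reasoning
    open +-*-Solver
  sum-differ {suc n} (suc w) {f} {g} eq = begin
    f zero + sum (f ∘ suc) + g (suc w)     ≡⟨ +-assoc (f zero) _ _ ⟩
    f zero + (sum (f ∘ suc) + g (suc w))   ≡⟨ cong₂ _+_ (eq zero λ ()) (sum-differ w (λ i i≢w → eq (suc i) (i≢w ∘ Fin.suc-injective))) ⟩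
    g zero + (sum (g ∘ suc) + f (suc w))   ≡⟨ +-assoc (g zero) _ _ ⟨
    g zero + sum (g ∘ suc) + f (suc w)     ∎
    where open ≡-Reasoning

  module _ {n} (u v : Fin n) where

    -- A view indexed by the value of the transposition: matching on it replaces that value and
    -- supplies the equations of the case.
    data Transposed (x : Fin n) : Fin n → Set where
      at-left   : x ≡ u → Transposed x v
      at-right  : x ≢ u → x ≡ v → Transposed x u
      elsewhere : x ≢ u → x ≢ v → Transposed x x

    transposed : ∀ x → Transposed x (PC.transpose u v x)
    transposed x with x Fin.≟ u
    ... | yes x≡u = at-left x≡u
    ... | no  x≢u with x Fin.≟ v
    ...   | yes x≡v = at-right x≢u x≡v
    ...   | no  x≢v = elsewhere x≢u x≢v

  -- Otherwise the transposition of `u` and `v` would map the neighbours of `u` into those of `v`,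
  -- and `u` would not have the larger degree. The condition `w ≢ v` keeps the moved edge from
  -- becoming a loop.
  private-neighbour : (G : Graph n) {u v : Fin n} → deg G v < deg G u →
                      ∃ λ w → w ≢ v × adj G u w ≡ true × adj G v w ≡ false
  private-neighbour {n} G {u} {v} lt
    with Fin.any? (λ w → ¬? (w Fin.≟ v) ×-dec (adj G u w Bool.≟ true) ×-dec (adj G v w Bool.≟ false))
  ... | yes found = found
  ... | no  none  = contradiction lt (≤⇒≯ (begin
    deg G u                        ≡⟨ sum-permute (λ w → ind (adj G u w)) (transpose u v) ⟩
    sum (λ w → ind (adj G u (τ w))) ≤⟨ sum-mono-≤ (λ w → ind-mono (covered w)) ⟩
    deg G v                        ∎))
    where
    open ≤-Reasoning
    τ = PC.transpose u v
    covered : ∀ w → adj G u (τ w) ≡ true → adj G v w ≡ true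
    covered w eq with τ w | transposed u v w
    ... | _ | at-left refl     = trans (Graph.sym G v u) eq
    ... | _ | at-right _ refl  = contradiction (trans (sym eq) (irrefl G u)) λ ()
    ... | _ | elsewhere _ w≢v  with adj G v w in vw
    ...   | true  = refl
    ...   | false = contradiction (w , w≢v , eq , vw) none

  module Switch (G : Graph n) {u v w : Fin n} (w≢v : w ≢ v) (uw : adj G u w ≡ true) (vw : adj G v w ≡ false) where

    τ : Fin n → Fin n
    τ = PC.transpose u v

    w≢u : w ≢ u
    w≢u refl = contradiction (trans (sym uw) (irrefl G w)) λ ()

    τw : τ w ≡ w
    τw with τ w | transposed u v w
    ... | _ | at-left w≡u    = contradiction w≡u w≢u
    ... | _ | at-right _ w≡v = contradiction w≡v w≢v
    ... | _ | elsewhere _ _  = refl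

    -- Row and column `w` are composed with the transposition of `u` and `v`. As `w` is adjacent to
    -- `u` but not to `v`, this replaces the edge `uw` by `vw`, and the degree of `w` is kept
    -- because its row is merely permuted.
    adj′ : Fin n → Fin n → Bool
    adj′ x y with x Fin.≟ w | y Fin.≟ w
    ... | yes _ | _     = adj G w (τ y)
    ... | no  _ | yes _ = adj G (τ x) w
    ... | no  _ | no  _ = adj G x y

    sym′ : ∀ x y → adj′ x y ≡ adj′ y x
    sym′ x y with x Fin.≟ w | y Fin.≟ w
    ... | yes refl | yes refl = refl
    ... | yes refl | no  _    = Graph.sym G w (τ y)
    ... | no  _    | yes refl = Graph.sym G (τ x) w
    ... | no  _    | no  _    = Graph.sym G x y

    irrefl′ : ∀ x → adj′ x x ≡ false
    irrefl′ x with x Fin.≟ w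
    ... | yes refl = trans (cong (adj G x) τw) (irrefl G x)
    ... | no  _    = irrefl G x

    switched : Graph n
    switched = record { adj = adj′ ; sym = sym′ ; irrefl = irrefl′ }

    adj′-row : ∀ y → adj′ w y ≡ adj G w (τ y)
    adj′-row y with w Fin.≟ w
    ... | yes _   = refl
    ... | no  w≢w = contradiction refl w≢w

    adj′-column : ∀ {x} → x ≢ w → adj′ x w ≡ adj G (τ x) w
    adj′-column {x} x≢w with x Fin.≟ w | w Fin.≟ w
    ... | yes x≡w | _       = contradiction x≡w x≢w
    ... | no  _   | yes _   = refl
    ... | no  _   | no  w≢w = contradiction refl w≢w

    adj′-else : ∀ {x y} → x ≢ w → y ≢ w → adj′ x y ≡ adj G x y
    adj′-else {x} {y} x≢w y≢w with x Fin.≟ w | y Fin.≟ w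
    ... | yes x≡w | _       = contradiction x≡w x≢w
    ... | no  _   | yes y≡w = contradiction y≡w y≢w
    ... | no  _   | no  _   = refl

    u≢v : u ≢ v
    u≢v refl = contradiction (trans (sym uw) vw) λ ()

    column-shift : ∀ x → ind (adj G (τ x) w) + (x [≟] u) ≡ ind (adj G x w) + (x [≟] v)
    column-shift x with τ x | transposed u v x
    ... | _ | at-left refl rewrite uw | vw | [≟]-refl x | [≟]-≢ u≢v = refl
    ... | _ | at-right x≢u refl rewrite uw | vw | [≟]-refl x | [≟]-≢ x≢u = refl
    ... | _ | elsewhere x≢u x≢v rewrite [≟]-≢ x≢u | [≟]-≢ x≢v = refl

    deg-switched-w : deg switched w + (w [≟] u) ≡ deg G w + (w [≟] v)
    deg-switched-w = cong₂ _+_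
      (trans (sum-cong-≗ (λ y → cong ind (adj′-row y))) (sym (sum-permute (λ y → ind (adj G w y)) (transpose u v))))
      (trans ([≟]-≢ w≢u) (sym ([≟]-≢ w≢v)))

    -- Row `x` changes only in column `w`; the old entry there is added to both sides so that
    -- `sum-differ` applies.
    deg-switched-≢ : ∀ {x} → x ≢ w → deg switched x + (x [≟] u) ≡ deg G x + (x [≟] v)
    deg-switched-≢ {x} x≢w = +-cancelʳ-≡ (ind (adj G x w)) _ _ (begin
      D′ + e + a             ≡⟨ solve 3 (λ D e a → D :+ e :+ a := D :+ a :+ e) refl D′ e a ⟩
      D′ + a + e             ≡⟨ cong (_+ e) (sum-differ w (λ y y≢w → cong ind (adj′-else x≢w y≢w))) ⟩
      D + ind (adj′ x w) + e ≡⟨ +-assoc D _ e ⟩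
      D + (ind (adj′ x w) + e) ≡⟨ cong (λ b → D + (ind b + e)) (adj′-column x≢w) ⟩
      D + (ind (adj G (τ x) w) + e) ≡⟨ cong (D +_) (column-shift x) ⟩
      D + (a + e′)           ≡⟨ solve 3 (λ D e a → D :+ (a :+ e) := D :+ e :+ a) refl D e′ a ⟩
      D + e′ + a             ∎)
      where
      open ≡-Reasoning
      open +-*-Solver
      D  = deg G x
      D′ = deg switched x
      a  = ind (adj G x w)
      e  = x [≟] u
      e′ = x [≟] v

    deg-switched : ∀ x → deg switched x + (x [≟] u) ≡ deg G x + (x [≟] v)
    deg-switched x = case x Fin.≟ w of λ where
      (yes refl) → deg-switched-w
      (no x≢w)   → deg-switched-≢ x≢w

  transfer : (G : Graph n) {u v : Fin n} → deg G v < deg G u →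
             Σ (Graph n) λ G′ → ∀ x → deg G′ x + (x [≟] u) ≡ deg G x + (x [≟] v)
  transfer G lt =
    let w , w≢v , uw , vw = private-neighbour G lt
        open Switch G w≢v uw vw
    in switched , deg-switched

  -- The target d is reached by unit transfers from vertices of excess to vertices of deficit.  As long as
  -- some vertex below p has too small a degree, the donor is a vertex below p of degree above A; afterwards
  -- donors have index at most p and recipients index at least p, and d decreases.
  module Realise (d : Fin n → ℕ) (p A : ℕ) (d≤A : ∀ x → d x ≤ A)
                 (d-antitone : ∀ {x y} → toℕ x ≤ toℕ y → d y ≤ d x) where

    -- The first `p` vertices have average degree at least `A`. A transfer inside the head preserves
    -- this sum but not the single degrees, and by averaging a head vertex below `A` forces another
    -- one above `A`.
    HeadRich : (Fin n → ℕ) → Set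
    HeadRich g = sum {n} (λ x → (x [<] p) * A) ≤ sum (λ x → (x [<] p) * g x)

    HeadDone : (Fin n → ℕ) → Set
    HeadDone g = ∀ x → toℕ x < p → d x ≤ g x

    record Invariant (g : Fin n → ℕ) : Set where
      field
        total : sum g ≡ sum d
        -- Strict: vertex `p` belongs to neither head nor tail, since its block of the threshold
        -- graph may be partly filled.
        tail  : ∀ x → p < toℕ x → g x ≤ d x
        head  : HeadRich g ⊎ HeadDone g

    module _ {g : Fin n → ℕ} (inv : Invariant g) where
      open Invariant inv

      deficit : ∀ u → d u < g u → ∃ λ v → g v < d v
      deficit u du<gu with Fin.any? (λ v → g v <? d v)
      ... | yes found = found
      ... | no  none  = contradiction (sym total)
        (<⇒≢ (sum-mono-< (λ v → ≮⇒≥ (none ∘ (v ,_))) u du<gu))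

      rich-donor : HeadRich g → ∀ v → toℕ v < p → g v < A → ∃ λ u → toℕ u < p × A < g u
      rich-donor rich v v<p gv<A with Fin.any? (λ u → (toℕ u <? p) ×-dec (A <? g u))
      ... | yes found = found
      ... | no  none  = contradiction rich (<⇒≱ (sum-mono-< below v strict))
        where
        below : ∀ x → (x [<] p) * g x ≤ (x [<] p) * A
        below x with toℕ x <? p
        ... | yes x<p rewrite [<]-yes {i = x} x<p = +-monoˡ-≤ 0 (≮⇒≥ (λ A<gx → none (x , x<p , A<gx)))
        ... | no  x≮p rewrite [<]-no {i = x} x≮p = z≤n
        strict : (v [<] p) * g v < (v [<] p) * A
        strict rewrite [<]-yes {i = v} v<p = +-monoˡ-< 0 gv<A

      record Move : Set where
        field
          u v       : Fin n
          excess    : d u < g u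
          shortfall : g v < d v
          gap       : g v < g u
          -- In the second case both ends of the transfer lie below `p`, which leaves the head sum
          -- unchanged.
          head′     : HeadDone g ⊎ (HeadRich g × toℕ u < p × toℕ v < p)

      -- An excess can occur only up to `p` and a deficit only from `p` on, so monotonicity of the
      -- target gives `g v < d v ≤ d u < g u`, the gap that a transfer needs.
      late-move : HeadDone g → ∀ u → d u < g u → Move
      late-move done u du<gu with deficit u du<gu
      ... | v , gv<dv = record
        { u = u ; v = v ; excess = du<gu ; shortfall = gv<dv
        ; gap = <-trans (<-≤-trans gv<dv (d-antitone (≤-trans u≤p p≤v))) du<gu ; head′ = inj₁ done }
        where
        u≤p : toℕ u ≤ p
        u≤p = ≮⇒≥ (λ p<u → <⇒≱ du<gu (tail u p<u))
        p≤v : p ≤ toℕ v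
        p≤v = ≮⇒≥ (λ v<p → <⇒≱ gv<dv (done v v<p))

      early-move : HeadRich g → ∀ v → toℕ v < p → g v < d v → Move
      early-move rich v v<p gv<dv with rich-donor rich v v<p (<-≤-trans gv<dv (d≤A v))
      ... | u , u<p , A<gu = record
        { u = u ; v = v ; excess = ≤-<-trans (d≤A u) A<gu ; shortfall = gv<dv
        ; gap = <-trans (<-≤-trans gv<dv (d≤A v)) A<gu ; head′ = inj₂ (rich , u<p , v<p) }

      move : ∀ u → d u < g u → Move
      move u du<gu with head
      ... | inj₂ done = late-move done u du<gu
      ... | inj₁ rich with Fin.any? (λ v → (toℕ v <? p) ×-dec (g v <? d v))
      ...   | yes (v , v<p , gv<dv) = early-move rich v v<p gv<dv
      ...   | no  none = late-move (λ v v<p → ≮⇒≥ (λ gv<dv → none (v , v<p , gv<dv))) u du<gu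

      module After (μ : Move) {g′ : Fin n → ℕ}
                   (shift : ∀ x → g′ x + (x [≟] Move.u μ) ≡ g x + (x [≟] Move.v μ)) where
        open Move μ

        u≢v : u ≢ v
        u≢v u≡v = <-irrefl (cong g (sym u≡v)) gap

        drop : suc (g′ u) ≡ g u
        drop = begin
          suc (g′ u)          ≡⟨ +-comm 1 (g′ u) ⟩
          g′ u + 1            ≡⟨ cong (g′ u +_) ([≟]-refl u) ⟨
          g′ u + (u [≟] u)    ≡⟨ shift u ⟩
          g u + (u [≟] v)     ≡⟨ cong (g u +_) ([≟]-≢ u≢v) ⟩
          g u + 0             ≡⟨ +-identityʳ (g u) ⟩
          g u                 ∎
          where open ≡-Reasoning

        data At (x : Fin n) : Set where
          donor     : x ≡ u → At x
          recipient : x ≡ v → g′ x ≡ suc (g x) → At x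
          other     : g′ x ≡ g x → At x

        at : ∀ x → At x
        at x with x Fin.≟ u | x Fin.≟ v | shift x
        ... | yes refl | yes x≡v | _  = contradiction x≡v u≢v
        ... | yes refl | no  _   | _ = donor refl
        ... | no  _    | yes refl | eq = recipient refl (trans (sym (+-identityʳ _)) (trans eq (+-comm _ 1)))
        ... | no  _    | no  _   | eq = other (+-cancelʳ-≡ 0 _ _ eq)

        stays-below : ∀ x → g x ≤ d x → g′ x ≤ d x
        stays-below x gx≤dx with at x
        ... | donor refl = ≤-trans (n≤1+n _) (≤-trans (≤-reflexive drop) gx≤dx)
        ... | recipient refl eq = ≤-trans (≤-reflexive eq) shortfall
        ... | other eq = ≤-trans (≤-reflexive eq) gx≤dx

        stays-above : ∀ x → d x ≤ g x → d x ≤ g′ x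
        stays-above x dx≤gx with at x
        ... | donor refl = s≤s⁻¹ (subst (d u <_) (sym drop) excess)
        ... | recipient _ eq = ≤-trans (m≤n⇒m≤1+n dx≤gx) (≤-reflexive (sym eq))
        ... | other eq = ≤-trans dx≤gx (≤-reflexive (sym eq))

        -- The donor loses one unit of excess. The recipient does not pass its target, so its
        -- truncated difference is zero before and after.
        excess-decreases : sum (λ x → g′ x ∸ d x) < sum (λ x → g x ∸ d x)
        excess-decreases = sum-mono-< weakly u strictly
          where
          weakly : ∀ x → g′ x ∸ d x ≤ g x ∸ d x
          weakly x with at x
          ... | donor refl = ∸-monoˡ-≤ (d u) (≤-trans (n≤1+n _) (≤-reflexive drop))
          ... | recipient refl eq = ≤-trans (≤-reflexive (m≤n⇒m∸n≡0 (≤-trans (≤-reflexive eq) shortfall))) z≤n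
          ... | other eq = ≤-reflexive (cong (_∸ d x) eq)
          strictly : g′ u ∸ d u < g u ∸ d u
          strictly = subst (λ gu → g′ u ∸ d u < gu ∸ d u) drop
            (∸-monoˡ-< (n<1+n (g′ u)) (s≤s⁻¹ (subst (d u <_) (sym drop) excess)))

        invariant : Invariant g′
        invariant = record { total = total′ ; tail = λ x p<x → stays-below x (tail x p<x) ; head = head″ head′ }
          where
          total′ : sum g′ ≡ sum d
          total′ = trans (+-cancelʳ-≡ 1 _ _ (begin
            sum g′ + 1                   ≡⟨ cong (sum g′ +_) (sum-[≟]-1 u) ⟨
            sum g′ + sum (_[≟] u)        ≡⟨ ∑-distrib-+ g′ _ ⟨
            sum (λ x → g′ x + (x [≟] u)) ≡⟨ sum-cong-≗ shift ⟩
            sum (λ x → g x + (x [≟] v))  ≡⟨ ∑-distrib-+ g _ ⟩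
            sum g + sum (_[≟] v)         ≡⟨ cong (sum g +_) (sum-[≟]-1 v) ⟩
            sum g + 1                    ∎)) total
            where open ≡-Reasoning
          head″ : HeadDone g ⊎ (HeadRich g × toℕ u < p × toℕ v < p) → HeadRich g′ ⊎ HeadDone g′
          head″ (inj₁ done) = inj₂ λ x x<p → stays-above x (done x x<p)
          head″ (inj₂ (rich , u<p , v<p)) = inj₁ (≤-trans rich (≤-reflexive (+-cancelʳ-≡ 1 _ _ (sym (begin
            sum (λ x → (x [<] p) * g′ x) + 1          ≡⟨ cong (_ +_) ([<]-yes u<p) ⟨
            sum (λ x → (x [<] p) * g′ x) + (u [<] p)  ≡⟨ sum-shift (_[<] p) u v shift ⟩
            sum (λ x → (x [<] p) * g x) + (v [<] p)   ≡⟨ cong (_ +_) ([<]-yes v<p) ⟩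
            sum (λ x → (x [<] p) * g x) + 1           ∎)))))
            where open ≡-Reasoning

    -- `fuel` bounds the total excess. Once no vertex exceeds its target, equality of the sums
    -- forces equality everywhere.
    realise′ : ∀ fuel (G : Graph n) → sum (λ x → deg G x ∸ d x) < fuel → Invariant (deg G) →
               Σ (Graph n) λ G′ → ∀ x → deg G′ x ≡ d x
    realise′ (suc fuel) G (s≤s bound) inv with Fin.any? (λ u → d u <? deg G u)
    ... | no  none = G , sum-≡⇒≗ (λ x → ≮⇒≥ (none ∘ (x ,_))) (Invariant.total inv)
    ... | yes (u , du<gu) =
      let μ = move inv u du<gu
          G′ , shift = transfer G (Move.gap μ)
          module μ = After inv μ shift
      in realise′ fuel G′ (<-≤-trans μ.excess-decreases bound) μ.invariant

    realise : (G : Graph n) → Invariant (deg G) → Σ (Graph n) λ G′ → ∀ x → deg G′ x ≡ d x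
    realise G = realise′ _ G ≤-refl

  -- Threshold graphs

  does-true : {P : Set} (P? : Dec P) → does P? ≡ true → P
  does-true (yes p) _ = p

  ind-does-⊎ : {P Q R : Set} (P? : Dec P) (Q? : Dec Q) (R? : Dec R) → (P → Q ⊎ R) →
               ind (does P?) ≤ ind (does Q?) + ind (does R?)
  ind-does-⊎ (no _)  Q? R? imp = z≤n
  ind-does-⊎ (yes p) Q? R? imp with imp p
  ... | inj₁ q rewrite dec-true Q? q = s≤s z≤n
  ... | inj₂ r rewrite dec-true R? r = m≤n+m 1 (ind (does Q?))

  2ab≤a²+b² : ∀ a b → 2 * (a * b) ≤ a * a + b * b
  2ab≤a²+b² a b = [ ordered a b , subst₂ _≤_ (cong (2 *_) (*-comm b a)) (+-comm (b * b) (a * a)) ∘ ordered b a ]′ (≤-total a b)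
    where
    ordered : ∀ a b → a ≤ b → 2 * (a * b) ≤ a * a + b * b
    ordered a b a≤b = subst (λ b → 2 * (a * b) ≤ a * a + b * b) (m+[n∸m]≡n a≤b)
      (≤-trans (m≤m+n _ (c * c)) (≤-reflexive
        (solve 2 (λ a c → con 2 :* (a :* (a :+ c)) :+ c :* c := a :* a :+ (a :+ c) :* (a :+ c)) refl a c)))
      where
      open +-*-Solver
      c = b ∸ a

  intermediate-value : (φ : ℕ → ℕ) (N : ℕ) {m : ℕ} → φ 0 ≤ m → (∀ i → φ (suc i) ≤ suc (φ i)) → m ≤ φ N →
                       ∃ λ i → i ≤ N × φ i ≡ m
  intermediate-value φ zero    φ0≤m step m≤φN = 0 , ≤-refl , ≤-antisym φ0≤m m≤φN
  intermediate-value φ (suc N) φ0≤m step m≤φN with m≤n⇒m<n∨m≡n m≤φN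
  ... | inj₂ m≡φN = suc N , ≤-refl , sym m≡φN
  ... | inj₁ m<φN =
    let i , i≤N , eq = intermediate-value φ N φ0≤m step (s≤s⁻¹ (≤-trans m<φN (step N)))
    in i , m≤n⇒m≤1+n i≤N , eq

  double-injective : ∀ {a b} → a + a ≡ b + b → a ≡ b
  double-injective {a} {b} eq with <-cmp a b
  ... | tri< a<b _ _ = contradiction eq (<⇒≢ (+-mono-< a<b a<b))
  ... | tri≈ _ a≡b _ = a≡b
  ... | tri> _ _ b<a = contradiction (sym eq) (<⇒≢ (+-mono-< b<a b<a))

  double-cancel-≤ : ∀ {a b} → a + a ≤ b + b → a ≤ b
  double-cancel-≤ {a} {b} le = ≮⇒≥ (λ b<a → <⇒≱ (+-mono-< b<a b<a) le)

  block-< : ∀ {c c′ r r′ n} → r < n → c < c′ → c * n + r < c′ * n + r′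
  block-< {c} {c′} {r} {r′} {n} r<n c<c′ = begin-strict
    c * n + r   <⟨ +-monoʳ-< (c * n) r<n ⟩
    c * n + n   ≡⟨ +-comm (c * n) n ⟩
    suc c * n   ≤⟨ *-monoˡ-≤ n c<c′ ⟩
    c′ * n      ≤⟨ m≤m+n _ r′ ⟩
    c′ * n + r′ ∎
    where open ≤-Reasoning

  block-injective : ∀ {c c′ r r′ n} → r < n → r′ < n → c * n + r ≡ c′ * n + r′ → c ≡ c′ × r ≡ r′
  block-injective {c} {c′} {n = n} r<n r′<n eq with <-cmp c c′
  ... | tri< c<c′ _ _ = contradiction eq (<⇒≢ (block-< r<n c<c′))
  ... | tri> _ _ c′<c = contradiction (sym eq) (<⇒≢ (block-< r′<n c′<c))
  ... | tri≈ _ refl _ = refl , +-cancelˡ-≡ (c * n) _ _ eq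

  sum-unique : {R : Fin n → Fin n → Set} (R? : ∀ u v → Dec (R u v)) →
               (∀ {u v u′ v′} → R u v → R u′ v′ → u ≡ u′ × v ≡ v′) →
               sum (λ u → sum (λ v → ind (does (R? u v)))) ≤ 1
  sum-unique {n} {R} R? unique with Fin.any? (λ u → Fin.any? (R? u))
  ... | no  none = ≤-trans (sum-mono-≤ (λ u → sum-mono-≤ (λ v →
    ≤-reflexive (cong ind (dec-false (R? u v) (λ r → none (u , v , r)))))))
    (≤-trans (≤-reflexive (trans (sum-cong-≗ (λ (_ : Fin n) → zero-sum)) zero-sum)) z≤n)
    where
    zero-sum : sum {n} (λ _ → 0) ≡ 0
    zero-sum = trans (sum-const n 0) (*-zeroʳ n)
  ... | yes (u₀ , v₀ , r₀) = begin
    sum (λ u → sum (λ v → ind (does (R? u v))))      ≤⟨ sum-mono-≤ (λ u → sum-mono-≤ (λ v → bound u v)) ⟩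
    sum (λ u → sum (λ v → (u [≟] u₀) * (v [≟] v₀)))  ≡⟨ sum-cong-≗ (λ u → sum-[≟] (λ _ → u [≟] u₀) v₀) ⟩
    sum (_[≟] u₀)                                    ≡⟨ sum-[≟]-1 u₀ ⟩
    1                                                ∎
    where
    open ≤-Reasoning
    bound : ∀ u v → ind (does (R? u v)) ≤ (u [≟] u₀) * (v [≟] v₀)
    bound u v with R? u v
    ... | no  _ = z≤n
    ... | yes r with unique r r₀
    ...   | refl , refl rewrite [≟]-refl u₀ | [≟]-refl v₀ = ≤-refl

  -- The pairs u < v are ordered by blocks: block u collects the pairs with smaller element u < δ, and block v
  -- those with larger element v and smaller element at least δ.  The i-th threshold graph consists of the
  -- pairs of rank below i: first δ dominating vertices, then a growing clique.
  module Threshold (n δ : ℕ) where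

    major minor rank : Fin n → Fin n → ℕ
    major u v = if does (toℕ u <? δ) then toℕ u else toℕ v
    minor u v = if does (toℕ u <? δ) then toℕ v else toℕ u
    rank  u v = major u v * n + minor u v

    major-< : ∀ {u} v → toℕ u < δ → major u v ≡ toℕ u
    major-< {u} v u<δ rewrite dec-true (toℕ u <? δ) u<δ = refl

    major-≥ : ∀ {u} v → δ ≤ toℕ u → major u v ≡ toℕ v
    major-≥ {u} v δ≤u rewrite dec-false (toℕ u <? δ) (≤⇒≯ δ≤u) = refl

    minor-< : ∀ {u} v → toℕ u < δ → minor u v ≡ toℕ v
    minor-< {u} v u<δ rewrite dec-true (toℕ u <? δ) u<δ = refl

    minor-≥ : ∀ {u} v → δ ≤ toℕ u → minor u v ≡ toℕ u
    minor-≥ {u} v δ≤u rewrite dec-false (toℕ u <? δ) (≤⇒≯ δ≤u) = refl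

    minor<n : ∀ u v → minor u v < n
    minor<n u v with does (toℕ u <? δ)
    ... | true  = Fin.toℕ<n v
    ... | false = Fin.toℕ<n u

    -- Within one kind of block the two coordinates recover the pair. Blocks of different kinds have
    -- different numbers: below `δ` if the smaller element is below `δ`, and above `δ` otherwise.
    rank-injective : ∀ {u v u′ v′} → u Fin.< v → u′ Fin.< v′ → rank u v ≡ rank u′ v′ → u ≡ u′ × v ≡ v′
    rank-injective {u} {v} {u′} {v′} u<v u′<v′ eq =
      uncurry coordinates (block-injective (minor<n u v) (minor<n u′ v′) eq)
      where
      coordinates : major u v ≡ major u′ v′ → minor u v ≡ minor u′ v′ → u ≡ u′ × v ≡ v′
      coordinates M m with toℕ u <? δ | toℕ u′ <? δ
      ... | yes u<δ | yes u′<δ rewrite major-< v u<δ | major-< v′ u′<δ | minor-< v u<δ | minor-< v′ u′<δ =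
        Fin.toℕ-injective M , Fin.toℕ-injective m
      ... | no  u≮δ | no  u′≮δ
        rewrite major-≥ v (≮⇒≥ u≮δ) | major-≥ v′ (≮⇒≥ u′≮δ) | minor-≥ v (≮⇒≥ u≮δ) | minor-≥ v′ (≮⇒≥ u′≮δ) =
        Fin.toℕ-injective m , Fin.toℕ-injective M
      ... | yes u<δ | no  u′≮δ rewrite major-< v u<δ | major-≥ v′ (≮⇒≥ u′≮δ) =
        contradiction (≤-<-trans (≮⇒≥ u′≮δ) (<-trans u′<v′ (subst (_< δ) M u<δ))) (<-irrefl refl)
      ... | no  u≮δ | yes u′<δ rewrite major-≥ v (≮⇒≥ u≮δ) | major-< v′ u′<δ =
        contradiction (≤-<-trans (≮⇒≥ u≮δ) (<-trans u<v (subst (_< δ) (sym M) u′<δ))) (<-irrefl refl)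

    Below : ℕ → Fin n → Fin n → Set
    Below i u v = u Fin.< v × rank u v < i

    below? : ∀ i u v → Dec (Below i u v)
    below? i u v = (u Fin.<? v) ×-dec (rank u v <? i)

    joined? : ∀ i u v → Dec (Below i u v ⊎ Below i v u)
    joined? i u v = below? i u v ⊎-dec below? i v u

    graph : ℕ → Graph n
    graph i = record
      { adj    = λ u v → does (joined? i u v)
      ; sym    = λ u v → Bool.∨-comm (does (below? i u v)) _
      ; irrefl = λ v → dec-false (joined? i v v) [ <-irrefl refl ∘ proj₁ , <-irrefl refl ∘ proj₁ ]′
      }

    edgeCount-graph : ∀ i → edgeCount (graph i) ≡ sum (λ u → sum (λ v → ind (does (below? i u v))))
    edgeCount-graph i = trans (edgeCount≡sum (graph i)) (sum-cong-≗ (λ u → sum-cong-≗ (λ v → cong ind (same u v))))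
      where
      same : ∀ u v → does (u Fin.<? v) ∧ does (joined? i u v) ≡ does (below? i u v)
      same u v with toℕ u <ᵇ toℕ v in eq
      ... | false = refl
      ... | true  rewrite dec-false (v Fin.<? u) (<⇒≯ (does-true (u Fin.<? v) eq)) = Bool.∨-identityʳ _

    edgeCount-0 : edgeCount (graph 0) ≡ 0
    edgeCount-0 = trans (edgeCount-graph 0) (trans
      (sum-cong-≗ (λ u → trans (sum-cong-≗ (λ v → cong ind (dec-false (below? 0 u v) λ ()))) zero-sum)) zero-sum)
      where
      zero-sum : sum {n} (λ _ → 0) ≡ 0
      zero-sum = trans (sum-const n 0) (*-zeroʳ n)

    -- At most one pair has rank `i`. Hence the edge count skips no value, and some graph of the
    -- family has exactly `m` edges.
    edgeCount-step : ∀ i → edgeCount (graph (suc i)) ≤ suc (edgeCount (graph i))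
    edgeCount-step i = begin
      edgeCount (graph (suc i))                       ≡⟨ edgeCount-graph (suc i) ⟩
      sum (λ u → sum (λ v → ind (does (below? (suc i) u v))))
        ≤⟨ sum-mono-≤ (λ u → sum-mono-≤ (λ v → split u v)) ⟩
      sum (λ u → sum (λ v → ind (does (new? u v)) + ind (does (below? i u v))))
        ≡⟨ sum-cong-≗ (λ u → ∑-distrib-+ (λ v → ind (does (new? u v))) _) ⟩
      sum (λ u → sum (λ v → ind (does (new? u v))) + sum (λ v → ind (does (below? i u v))))
        ≡⟨ ∑-distrib-+ (λ u → sum (λ v → ind (does (new? u v)))) _ ⟩
      sum (λ u → sum (λ v → ind (does (new? u v)))) + sum (λ u → sum (λ v → ind (does (below? i u v))))
        ≤⟨ +-mono-≤ (sum-unique new? λ (u<v , eq) (u′<v′ , eq′) → rank-injective u<v u′<v′ (trans eq (sym eq′)))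
                    (≤-reflexive (sym (edgeCount-graph i))) ⟩
      suc (edgeCount (graph i))                       ∎
      where
      open ≤-Reasoning
      new? : ∀ u v → Dec (u Fin.< v × rank u v ≡ i)
      new? u v = (u Fin.<? v) ×-dec (rank u v ≟ i)
      split : ∀ u v → ind (does (below? (suc i) u v)) ≤ ind (does (new? u v)) + ind (does (below? i u v))
      split u v = ind-does-⊎ (below? (suc i) u v) (new? u v) (below? i u v) λ (u<v , r≤i) →
        case m≤n⇒m<n∨m≡n (s≤s⁻¹ r≤i) of λ where
          (inj₁ r<i) → inj₂ (u<v , r<i)
          (inj₂ r≡i) → inj₁ (u<v , r≡i)

    module _ .{{_ : NonZero n}} (i : ℕ) where

      p : ℕ
      p = i / n

      i≡ : i ≡ p * n + i % n
      i≡ = trans (m≡m%n+[m/n]*n i n) (+-comm (i % n) _)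

      rank-small : ∀ {u v} → major u v < p → rank u v < i
      rank-small {u} {v} lt = subst (rank u v <_) (sym i≡) (block-< (minor<n u v) lt)

      rank-large : ∀ {u v} → p < major u v → ¬ rank u v < i
      rank-large lt r<i = <-asym r<i (subst (_< _) (sym i≡) (block-< (m%n<n i n) lt))

      dominating : ∀ {u v} → toℕ u < p → toℕ u < δ → u ≢ v → adj (graph i) u v ≡ true
      dominating {u} {v} u<p u<δ u≢v with Fin.<-cmp u v
      ... | tri≈ _ u≡v _ = contradiction u≡v u≢v
      ... | tri< u<v _ _ = dec-true (joined? i u v) (inj₁ (u<v , rank-small (subst (_< p) (sym (major-< v u<δ)) u<p)))
      ... | tri> _ _ v<u = dec-true (joined? i u v)
        (inj₂ (v<u , rank-small (subst (_< p) (sym (major-< u (<-trans v<u u<δ))) (<-trans v<u u<p))))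

      major<p : ∀ {u v} → toℕ u < p → toℕ v < p → major u v < p
      major<p {u} u<p v<p with does (toℕ u <? δ)
      ... | true  = u<p
      ... | false = v<p

      clique : ∀ {u v} → toℕ u < p → toℕ v < p → u ≢ v → adj (graph i) u v ≡ true
      clique {u} {v} u<p v<p u≢v with Fin.<-cmp u v
      ... | tri≈ _ u≡v _ = contradiction u≡v u≢v
      ... | tri< u<v _ _ = dec-true (joined? i u v) (inj₁ (u<v , rank-small (major<p u<p v<p)))
      ... | tri> _ _ v<u = dec-true (joined? i u v) (inj₂ (v<u , rank-small (major<p v<p u<p)))

      -- If `w` were at least `δ`, the pair would lie in block `v`, or in block `w` with `w > v`; in
      -- either case beyond `p`, hence not yet present.
      peripheral : ∀ {v w} → p < toℕ v → adj (graph i) v w ≡ true → toℕ w < δ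
      peripheral {v} {w} p<v vw = ≰⇒> λ δ≤w → case does-true (joined? i v w) vw of λ where
        (inj₂ (w<v , r<i)) → rank-large (subst (p <_) (sym (major-≥ v δ≤w)) p<v) r<i
        (inj₁ (v<w , r<i)) → case toℕ v <? δ of λ where
          (yes v<δ) → rank-large (subst (p <_) (sym (major-< w v<δ)) p<v) r<i
          (no  v≮δ) → rank-large (subst (p <_) (sym (major-≥ w (≮⇒≥ v≮δ))) (<-trans p<v v<w)) r<i

      deg-dominating : ∀ u → toℕ u < p → toℕ u < δ → n ≤ suc (deg (graph i) u)
      deg-dominating u u<p u<δ = begin
        n                                        ≡⟨ trans (sum-const n 1) (*-identityʳ n) ⟨
        sum {n} (λ _ → 1)                        ≤⟨ sum-mono-≤ bound ⟩
        sum (λ v → (v [≟] u) + ind (adj (graph i) u v))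
                                                 ≡⟨ ∑-distrib-+ (_[≟] u) _ ⟩
        sum (_[≟] u) + deg (graph i) u           ≡⟨ cong (_+ deg (graph i) u) (sum-[≟]-1 u) ⟩
        suc (deg (graph i) u)                    ∎
        where
        open ≤-Reasoning
        bound : ∀ v → 1 ≤ (v [≟] u) + ind (adj (graph i) u v)
        bound v with v Fin.≟ u
        ... | yes _   = s≤s z≤n
        ... | no  v≢u rewrite dominating {u} {v} u<p u<δ (v≢u ∘ sym) = ≤-refl

      deg-clique : p ≤ n → ∀ u → toℕ u < p → p ≤ suc (deg (graph i) u)
      deg-clique p≤n u u<p = begin
        p                                        ≡⟨ sum-[<] p≤n ⟨
        sum {n} (_[<] p)                         ≤⟨ sum-mono-≤ bound ⟩
        sum (λ v → (v [≟] u) + ind (adj (graph i) u v))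
                                                 ≡⟨ ∑-distrib-+ (_[≟] u) _ ⟩
        sum (_[≟] u) + deg (graph i) u           ≡⟨ cong (_+ deg (graph i) u) (sum-[≟]-1 u) ⟩
        suc (deg (graph i) u)                    ∎
        where
        open ≤-Reasoning
        bound : ∀ v → v [<] p ≤ (v [≟] u) + ind (adj (graph i) u v)
        bound v with toℕ v <? p
        ... | no  v≮p rewrite [<]-no {i = v} v≮p = z≤n
        ... | yes v<p with v Fin.≟ u
        ...   | yes _   = ≤-trans (ind≤1 _) (s≤s z≤n)
        ...   | no  v≢u rewrite clique {u} {v} u<p v<p (v≢u ∘ sym) = ind≤1 _

      deg-peripheral : ∀ v → p < toℕ v → deg (graph i) v ≤ δ
      deg-peripheral v p<v = ≤-trans
        (sum-mono-≤ (λ w → ind-mono (λ vw → dec-true (toℕ w <? δ) (peripheral {v} {w} p<v vw))))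
        (sum-[<]≤ {n} δ)

  -- The theorem of Zverovich and Zverovich.
  module _ {n : ℕ} .{{_ : NonZero n}} {δ A m : ℕ} .{{_ : NonZero δ}} (d : Fin n → ℕ)
           (d-antitone : ∀ {x y} → toℕ x ≤ toℕ y → d y ≤ d x)
           (δ≤d : ∀ x → δ ≤ d x) (d≤A : ∀ x → d x ≤ A) (even : sum d ≡ m + m)
           (large : (A + δ + 1) * (A + δ + 1) ≤ 4 * (δ * n)) where
    open Threshold n δ

    -- By the inequality of the means `4δ(A + 1) ≤ (A + 1 + δ)² ≤ 4δn`. So a dominating vertex, of
    -- degree `n − 1`, reaches `A`.
    A<n : A < n
    A<n = *-cancelˡ-≤ (4 * δ) {{m*n≢0 4 δ}} (begin
      4 * δ * suc A                             ≤⟨ *-cancelˡ-≤ 2 amgm ⟩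
      (A + δ + 1) * (A + δ + 1)                 ≤⟨ large ⟩
      4 * (δ * n)                               ≡⟨ *-assoc 4 δ n ⟨
      4 * δ * n                                 ∎)
      where
      open ≤-Reasoning
      open +-*-Solver
      amgm : 2 * (4 * δ * suc A) ≤ 2 * ((A + δ + 1) * (A + δ + 1))
      amgm = begin
        2 * (4 * δ * suc A)
          ≡⟨ solve 2 (λ δ A → con 2 :* (con 4 :* δ :* (con 1 :+ A))
                := con 4 :* (δ :* (con 1 :+ A)) :+ con 2 :* (con 2 :* (δ :* (con 1 :+ A)))) refl δ A ⟩
        4 * (δ * suc A) + 2 * (2 * (δ * suc A))
          ≤⟨ +-monoʳ-≤ (4 * (δ * suc A)) (*-monoʳ-≤ 2 (2ab≤a²+b² δ (suc A))) ⟩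
        4 * (δ * suc A) + 2 * (δ * δ + suc A * suc A)
          ≡⟨ solve 2 (λ δ A → con 4 :* (δ :* (con 1 :+ A)) :+ con 2 :* (δ :* δ :+ (con 1 :+ A) :* (con 1 :+ A))
                := con 2 :* ((A :+ δ :+ con 1) :* (A :+ δ :+ con 1))) refl δ A ⟩
        2 * ((A + δ + 1) * (A + δ + 1)) ∎

    -- 4 p (A + δ + 1) ≤ 4 p² + (A + δ + 1)²
    clique-room : ∀ {p} → p ≤ n → p * suc A ≤ p * p + δ * (n ∸ p)
    clique-room {p} p≤n = +-cancelʳ-≤ (δ * p) _ _ (*-cancelˡ-≤ 4 (begin
      4 * (p * suc A + δ * p)
        ≡⟨ solve 3 (λ p A δ → con 4 :* (p :* (con 1 :+ A) :+ δ :* p)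
              := con 2 :* ((con 2 :* p) :* (A :+ δ :+ con 1))) refl p A δ ⟩
      2 * ((2 * p) * (A + δ + 1))
        ≤⟨ 2ab≤a²+b² (2 * p) (A + δ + 1) ⟩
      (2 * p) * (2 * p) + (A + δ + 1) * (A + δ + 1)
        ≤⟨ +-monoʳ-≤ _ large ⟩
      (2 * p) * (2 * p) + 4 * (δ * n)
        ≡⟨ cong (λ n → (2 * p) * (2 * p) + 4 * (δ * n)) (m∸n+n≡m p≤n) ⟨
      (2 * p) * (2 * p) + 4 * (δ * (n ∸ p + p))
        ≡⟨ solve 3 (λ p δ r → (con 2 :* p) :* (con 2 :* p) :+ con 4 :* (δ :* (r :+ p))
              := con 4 :* (p :* p :+ δ :* r :+ δ :* p)) refl p δ (n ∸ p) ⟩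
      4 * (p * p + δ * (n ∸ p) + δ * p) ∎))
      where
      open ≤-Reasoning
      open +-*-Solver

    -- For `p ≤ δ` every head vertex is dominating. Otherwise the head degrees are at least `p − 1`,
    -- and `n − 1` for the first `δ` vertices; their sum is at least `p² + δ(n − p) − p`, which
    -- `clique-room` compares with `p A`. Adding `p` on both sides avoids the subtraction.
    head-rich : ∀ i → p i ≤ n → sum {n} (λ x → (x [<] p i) * A) ≤ sum (λ x → (x [<] p i) * deg (graph i) x)
    head-rich i q≤n with ≤-total (p i) δ
    ... | inj₁ q≤δ = sum-mono-≤ bound
      where
      bound : ∀ x → (x [<] p i) * A ≤ (x [<] p i) * deg (graph i) x
      bound x with toℕ x <? p i
      ... | no  x≮q rewrite [<]-no {i = x} x≮q = z≤n
      ... | yes x<q rewrite [<]-yes {i = x} x<q =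
        +-monoˡ-≤ 0 (s≤s⁻¹ (≤-trans A<n (deg-dominating i x x<q (<-≤-trans x<q q≤δ))))
    ... | inj₂ δ≤q = +-cancelʳ-≤ (p i) _ _ (begin
      sum {n} (λ x → (x [<] p i) * A) + p i
        ≡⟨ cong (_+ p i) (trans (sum-cong-≗ (λ (x : Fin n) → *-comm (x [<] p i) A)) (sum-*-[<] A q≤n)) ⟩
      A * p i + p i
        ≡⟨ trans (+-comm (A * p i) (p i)) (*-comm (suc A) (p i)) ⟩
      p i * suc A
        ≤⟨ clique-room q≤n ⟩
      p i * p i + δ * (n ∸ p i)
        ≡⟨ cong₂ _+_ (sum-*-[<] (p i) q≤n) (trans (sum-*-[<] (n ∸ p i) (≤-trans δ≤q q≤n)) (*-comm (n ∸ p i) δ)) ⟨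
      sum {n} (λ x → p i * (x [<] p i)) + sum {n} (λ x → (n ∸ p i) * (x [<] δ))
        ≡⟨ ∑-distrib-+ {n} (λ x → p i * (x [<] p i)) _ ⟨
      sum {n} (λ x → p i * (x [<] p i) + (n ∸ p i) * (x [<] δ))
        ≤⟨ sum-mono-≤ bound ⟩
      sum (λ x → (x [<] p i) * deg (graph i) x + (x [<] p i))
        ≡⟨ ∑-distrib-+ (λ x → (x [<] p i) * deg (graph i) x) _ ⟩
      sum (λ x → (x [<] p i) * deg (graph i) x) + sum {n} (_[<] p i)
        ≡⟨ cong (sum (λ x → (x [<] p i) * deg (graph i) x) +_) (sum-[<] q≤n) ⟩
      sum (λ x → (x [<] p i) * deg (graph i) x) + p i ∎)
      where
      open ≤-Reasoning
      bound : ∀ x → p i * (x [<] p i) + (n ∸ p i) * (x [<] δ) ≤ (x [<] p i) * deg (graph i) x + (x [<] p i)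
      bound x with toℕ x <? δ | toℕ x <? p i
      ... | yes x<δ | no  x≮q = contradiction (<-≤-trans x<δ δ≤q) x≮q
      ... | yes x<δ | yes x<q rewrite [<]-yes {i = x} x<δ | [<]-yes {i = x} x<q = begin
        p i * 1 + (n ∸ p i) * 1         ≡⟨ cong₂ _+_ (*-identityʳ (p i)) (*-identityʳ (n ∸ p i)) ⟩
        p i + (n ∸ p i)                 ≡⟨ m+[n∸m]≡n q≤n ⟩
        n                               ≤⟨ deg-dominating i x x<q x<δ ⟩
        suc (deg (graph i) x)           ≡⟨ trans (+-comm 1 _) (cong (_+ 1) (sym (+-identityʳ _))) ⟩
        deg (graph i) x + 0 + 1         ∎
      ... | no  x≮δ | yes x<q rewrite [<]-no {i = x} x≮δ | [<]-yes {i = x} x<q = begin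
        p i * 1 + (n ∸ p i) * 0         ≡⟨ cong₂ _+_ (*-identityʳ (p i)) (*-zeroʳ (n ∸ p i)) ⟩
        p i + 0                         ≡⟨ +-identityʳ (p i) ⟩
        p i                             ≤⟨ deg-clique i q≤n x x<q ⟩
        suc (deg (graph i) x)           ≡⟨ trans (+-comm 1 _) (cong (_+ 1) (sym (+-identityʳ _))) ⟩
        deg (graph i) x + 0 + 1         ∎
      ... | no  x≮δ | no  x≮q rewrite [<]-no {i = x} x≮δ | [<]-no {i = x} x≮q =
        ≤-reflexive (cong₂ _+_ (*-zeroʳ (p i)) (*-zeroʳ (n ∸ p i)))

    -- At `n * n` every block is filled and the graph is complete; this ends the range in which a
    -- graph with `m` edges is sought.
    n≤1+deg-complete : ∀ u → n ≤ suc (deg (graph (n * n)) u)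
    n≤1+deg-complete u = subst (_≤ suc (deg (graph (n * n)) u)) p≡n
      (deg-clique (n * n) (≤-reflexive p≡n) u (subst (toℕ u <_) (sym p≡n) (Fin.toℕ<n u)))
      where
      p≡n : p (n * n) ≡ n
      p≡n = m*n/n≡m n n

    m≤complete : m ≤ edgeCount (graph (n * n))
    m≤complete = double-cancel-≤ (begin
      m + m                       ≡⟨ even ⟨
      sum d                       ≤⟨ sum-mono-≤ (λ x → s≤s⁻¹ (≤-trans (s≤s (d≤A x)) (≤-trans A<n (n≤1+deg-complete x)))) ⟩
      sum (deg (graph (n * n)))   ≡⟨ handshake (graph (n * n)) ⟩
      edgeCount (graph (n * n)) + edgeCount (graph (n * n)) ∎)
      where open ≤-Reasoning

    zverovich : Σ (Graph n) λ G → ∀ x → deg G x ≡ d x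
    zverovich
      with intermediate-value (edgeCount ∘ graph) (n * n) (≤-trans (≤-reflexive edgeCount-0) z≤n) edgeCount-step m≤complete
    ... | i , i≤n² , e≡m = realise (graph i) record
      { total = trans (handshake (graph i)) (trans (cong₂ _+_ e≡m e≡m) (sym even))
      ; tail  = λ x p<x → ≤-trans (deg-peripheral i x p<x) (δ≤d x)
      ; head  = inj₁ (head-rich i (≤-trans (/-monoˡ-≤ n i≤n²) (≤-reflexive (m*n/n≡m n n))))
      }
      where open Realise d (p i) A d≤A d-antitone

  -- Spread

  all-degreesOn : (G : Graph n) {B : Subset n} {P : ℕ → Set} →
                  (∀ v → v Subset.∈ B → P (degree G v)) → All P (degreesOn G B)
  all-degreesOn {n} G {B} {P} p = All.tabulate λ x∈ →
    case List.∈-map∘filter⁻ (degree G) (Subset._∈? B) {xs = List.allFin n} x∈ of λ where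
      (v , _ , refl , v∈B) → p v v∈B

  degree∈degreesOn : (G : Graph n) {B : Subset n} {v : Fin n} → v Subset.∈ B → degree G v List.∈ degreesOn G B
  degree∈degreesOn G {B} {v} v∈B =
    List.∈-map⁺ (degree G) (List.∈-filter⁺ (Subset._∈? B) (List.∈-allFin v) v∈B)

  minDegree≤degree : (G : Graph n) (v : Fin n) → minDegree G ≤ degree G v
  minDegree≤degree {n} G v = All.lookup (min≤xs n _) (degree∈degreesOn G Subset.∈⊤)

  minDegree≡ : (G : Graph n) {δ : ℕ} → (∀ v → δ ≤ degree G v) → (v : Fin n) → degree G v ≡ δ → minDegree G ≡ δ
  minDegree≡ {n} G δ≤ v refl =
    min≈v⁺ {⊤ = n} (degree∈degreesOn G {v = v} Subset.∈⊤) (all-degreesOn G (λ u _ → δ≤ u)) (Subset.∣p∣≤n (neighbours G v))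

  -- The default `n` of the minimum respects the lower bound `c` only if `c ≤ n`. For `c > n` no
  -- vertex qualifies, and the maximum is its default 0.
  spread-window : (G : Graph n) (B : Subset n) (c k : ℕ) →
                  (∀ v → v Subset.∈ B → c ≤ degree G v × degree G v ≤ c + k) → spread G B ≤ k
  spread-window {n} G B c k within with c ≤? n
  ... | yes c≤n = m≤n+o⇒m∸n≤o _ _ (≤-trans
    (max≤v⁺ z≤n (all-degreesOn G (λ v v∈B → proj₂ (within v v∈B))))
    (+-monoˡ-≤ k (v≤min⁺ c≤n (all-degreesOn G (λ v v∈B → proj₁ (within v v∈B))))))
  ... | no  c≰n = ≤-trans (m∸n≤m _ (minDegreeOn G B)) (≤-trans
    (max≤v⁺ {v = 0} z≤n (all-degreesOn G (λ v v∈B →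
      contradiction (≤-trans (proj₁ (within v v∈B)) (Subset.∣p∣≤n (neighbours G v))) c≰n))) z≤n)

  degree≤degree+spread : (G : Graph n) {B : Subset n} {u v : Fin n} → u Subset.∈ B → v Subset.∈ B →
                         degree G u ≤ degree G v + spread G B
  degree≤degree+spread {n} G {B} {u} {v} u∈B v∈B = begin
    degree G u                    ≤⟨ All.lookup (xs≤max 0 _) (degree∈degreesOn G u∈B) ⟩
    maxDegreeOn G B               ≤⟨ m≤n+m∸n _ (minDegreeOn G B) ⟩
    minDegreeOn G B + spread G B  ≤⟨ +-monoˡ-≤ _ (All.lookup (min≤xs n _) (degree∈degreesOn G v∈B)) ⟩
    degree G v + spread G B       ∎
    where open ≤-Reasoning

  ∈-subsets : (B : Subset n) → B List.∈ subsets n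
  ∈-subsets Vec.[]              = here refl
  ∈-subsets (inside  Vec.∷ B) = List.∈-++⁺ˡ (List.∈-map⁺ (inside Vec.∷_) (∈-subsets B))
  ∈-subsets (outside Vec.∷ B) = List.∈-++⁺ʳ _ (List.∈-map⁺ (outside Vec.∷_) (∈-subsets B))

  ∣∣≤sp : (G : Graph n) (k : ℕ) (B : Subset n) → spread G B ≤ k → ∣ B ∣ ≤ sp G k
  ∣∣≤sp G k B small = All.lookup (xs≤max 0 _)
    (List.∈-map⁺ ∣_∣ (List.∈-filter⁺ (λ B → spread G B ≤? k) (∈-subsets B) small))

  sp≤ : (G : Graph n) (k : ℕ) {s : ℕ} → (∀ B → spread G B ≤ k → ∣ B ∣ ≤ s) → sp G k ≤ s
  sp≤ {n} G k bound = max≤v⁺ z≤n (All.tabulate λ x∈ →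
    case List.∈-map∘filter⁻ ∣_∣ (λ B → spread G B ≤? k) {xs = subsets n} x∈ of λ where
      (B , _ , refl , small) → bound B small)

  ∣∣≤-initial : (B : Subset n) {s : ℕ} → (∀ {v} → v Subset.∈ B → toℕ v < s) → ∣ B ∣ ≤ s
  ∣∣≤-initial Vec.[] below = z≤n
  ∣∣≤-initial (outside Vec.∷ B) {s} below =
    ∣∣≤-initial B (λ v∈B → ≤-trans (n≤1+n _) (below (Vec.there v∈B)))
  ∣∣≤-initial (inside Vec.∷ B) {zero}  below = contradiction (below Vec.here) λ ()
  ∣∣≤-initial (inside Vec.∷ B) {suc s} below = s≤s (∣∣≤-initial B (λ v∈B → s≤s⁻¹ (below (Vec.there v∈B))))

  -- Once the leading absent indices are dropped, the least member has index 0, and all members are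
  -- then below `s`.
  ∣∣≤-diameter : (B : Subset n) {s : ℕ} → (∀ {u v} → u Subset.∈ B → v Subset.∈ B → toℕ v < toℕ u + s) → ∣ B ∣ ≤ s
  ∣∣≤-diameter Vec.[] close = z≤n
  ∣∣≤-diameter (outside Vec.∷ B) close = ∣∣≤-diameter B (λ u∈B v∈B → s≤s⁻¹ (close (Vec.there u∈B) (Vec.there v∈B)))
  ∣∣≤-diameter (inside  Vec.∷ B) close = ∣∣≤-initial (inside Vec.∷ B) (close Vec.here)

  -- Members of a set of spread at most `k` have degrees less than `k + 1` apart, hence indices less
  -- than `s` apart.
  sp≤-separated : (G : Graph n) (k s : ℕ) →
                  (∀ {u v} → toℕ u + s ≤ toℕ v → degree G v + suc k ≤ degree G u) → sp G k ≤ s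
  sp≤-separated G k s separated = sp≤ G k λ B small → ∣∣≤-diameter B λ {u} {v} u∈B v∈B →
    ≰⇒> λ u+s≤v → <⇒≱ (subst (_≤ degree G u) (+-suc (degree G v) k) (separated u+s≤v))
      (≤-trans (degree≤degree+spread G u∈B v∈B) (+-monoʳ-≤ (degree G v) small))

  -- The lower bound on `sp` by counting vertices of low degree

  module LowerBound (G : Graph n) (k δ : ℕ) (δ≤deg : ∀ v → δ ≤ deg G v) where

    h : ℕ
    h = suc k

    low : ℕ → Fin n → ℕ
    low c v = ind (does (deg G v <? c))

    window? : ∀ c v → Dec (c ≤ deg G v × deg G v ≤ c + k)
    window? c v = (c ≤? deg G v) ×-dec (deg G v ≤? c + k)

    sum-window≤sp : ∀ c → sum (λ v → ind (does (window? c v))) ≤ sp G k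
    sum-window≤sp c = ≤-trans (≤-reflexive (sym (∣tabulate∣ (does ∘ window? c))))
      (∣∣≤sp G k window (spread-window G window c k λ v v∈ →
        subst (λ x → c ≤ x × x ≤ c + k) (sym (degree≡deg G v))
          (does-true (window? c v) (trans (sym (Vec.lookup∘tabulate _ v)) (Vec.[]=⇒lookup v∈)))))
      where
      window : Subset n
      window = Vec.tabulate (does ∘ window? c)

    sum-low≤ : ∀ i → sum (low (δ + i * h)) ≤ i * sp G k
    sum-low≤ zero = ≤-reflexive (trans (sum-cong-≗ (λ v →
      cong ind (dec-false (deg G v <? δ + 0) (≤⇒≯ (subst (_≤ deg G v) (sym (+-identityʳ δ)) (δ≤deg v))))))
      (trans (sum-const n 0) (*-zeroʳ n)))
    sum-low≤ (suc i) = begin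
      sum (low (δ + suc i * h))
        ≤⟨ sum-mono-≤ (λ v → ind-does-⊎ (deg G v <? δ + suc i * h) (window? c v) (deg G v <? c) (split v)) ⟩
      sum (λ v → ind (does (window? c v)) + low c v)
        ≡⟨ ∑-distrib-+ (λ v → ind (does (window? c v))) _ ⟩
      sum (λ v → ind (does (window? c v))) + sum (low c)
        ≤⟨ +-mono-≤ (sum-window≤sp c) (sum-low≤ i) ⟩
      suc i * sp G k ∎
      where
      open ≤-Reasoning
      c = δ + i * h
      split : ∀ v → deg G v < δ + suc i * h → (c ≤ deg G v × deg G v ≤ c + k) ⊎ deg G v < c
      split v lt with deg G v <? c
      ... | yes v<c = inj₂ v<c
      ... | no  v≮c = inj₁ (≮⇒≥ v≮c , s≤s⁻¹ (subst (deg G v <_) eq lt))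
        where
        eq : δ + suc i * h ≡ suc (c + k)
        eq = solve 3 (λ δ i k → δ :+ (con 1 :+ k :+ i :* (con 1 :+ k))
              := con 1 :+ (δ :+ i :* (con 1 :+ k) :+ k)) refl δ i k
          where open +-*-Solver

    -- The number of levels `δ + i h` with `1 ≤ i ≤ t` that exceed the degree of `v`. Summed over
    -- `v`, it counts the low vertices level by level.
    deficiency : ℕ → Fin n → ℕ
    deficiency zero    v = 0
    deficiency (suc t) v = low (δ + suc t * h) v + deficiency t v

    -- Each level above the degree pays `h`, which together covers the distance up to the top level.
    level≤ : ∀ t v → δ + t * h ≤ deg G v + h * deficiency t v
    level≤ zero v = ≤-trans (≤-reflexive (+-identityʳ δ)) (≤-trans (δ≤deg v) (m≤m+n _ _))
    level≤ (suc t) v with deg G v <? δ + suc t * h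
    ... | no  v≮c = ≤-trans (≮⇒≥ v≮c) (m≤m+n _ _)
    ... | yes v<c rewrite dec-true (deg G v <? δ + suc t * h) v<c = begin
      δ + suc t * h                          ≡⟨ solve 3 (λ δ t h → δ :+ (h :+ t :* h)
            := δ :+ t :* h :+ h) refl δ t h ⟩
      δ + t * h + h                          ≤⟨ +-monoˡ-≤ h (level≤ t v) ⟩
      deg G v + h * deficiency t v + h       ≡⟨ solve 3 (λ D h e → D :+ h :* e :+ h
            := D :+ h :* (con 1 :+ e)) refl (deg G v) h (deficiency t v) ⟩
      deg G v + h * suc (deficiency t v)     ∎
      where
      open ≤-Reasoning
      open +-*-Solver

    sum-deficiency≤ : ∀ t → 2 * sum (deficiency t) ≤ sp G k * (t * suc t)
    sum-deficiency≤ zero = ≤-trans (≤-reflexive (cong (2 *_) (trans (sum-const n 0) (*-zeroʳ n)))) z≤n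
    sum-deficiency≤ (suc t) = begin
      2 * sum (deficiency (suc t))
        ≡⟨ cong (2 *_) (∑-distrib-+ (low (δ + suc t * h)) (deficiency t)) ⟩
      2 * (sum (low (δ + suc t * h)) + sum (deficiency t))
        ≡⟨ *-distribˡ-+ 2 (sum (low (δ + suc t * h))) _ ⟩
      2 * sum (low (δ + suc t * h)) + 2 * sum (deficiency t)
        ≤⟨ +-mono-≤ (*-monoʳ-≤ 2 (sum-low≤ (suc t))) (sum-deficiency≤ t) ⟩
      2 * (suc t * sp G k) + sp G k * (t * suc t)
        ≡⟨ solve 2 (λ t s → con 2 :* ((con 1 :+ t) :* s) :+ s :* (t :* (con 1 :+ t))
              := s :* ((con 1 :+ t) :* (con 2 :+ t))) refl t (sp G k) ⟩
      sp G k * (suc t * suc (suc t)) ∎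
      where
      open ≤-Reasoning
      open +-*-Solver

    -- This is `f_t ≤ sp` cleared of its denominator, with the negative term moved to the other
    -- side.
    sp-lower : ∀ t → 2 * (n * (δ + t * h)) ≤ 2 * (edgeCount G + edgeCount G) + h * (sp G k * (t * suc t))
    sp-lower t = begin
      2 * (n * (δ + t * h))
        ≡⟨ cong (2 *_) (sum-const n (δ + t * h)) ⟨
      2 * sum {n} (λ _ → δ + t * h)
        ≤⟨ *-monoʳ-≤ 2 (sum-mono-≤ (level≤ t)) ⟩
      2 * sum (λ v → deg G v + h * deficiency t v)
        ≡⟨ cong (2 *_) (trans (∑-distrib-+ (deg G) _) (cong₂ _+_ (handshake G) (sym (*-distribˡ-sum h (deficiency t))))) ⟩
      2 * (edgeCount G + edgeCount G + h * sum (deficiency t))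
        ≡⟨ solve 3 (λ e h D → con 2 :* (e :+ h :* D)
              := con 2 :* e :+ h :* (con 2 :* D)) refl (edgeCount G + edgeCount G) h (sum (deficiency t)) ⟩
      2 * (edgeCount G + edgeCount G) + h * (2 * sum (deficiency t))
        ≤⟨ +-monoʳ-≤ (2 * (edgeCount G + edgeCount G)) (*-monoʳ-≤ h (sum-deficiency≤ t)) ⟩
      2 * (edgeCount G + edgeCount G) + h * (sp G k * (t * suc t)) ∎
      where
      open ≤-Reasoning
      open +-*-Solver

  -- The extremal degree sequence

  -- A descent from `N` to the nearest failure. Only the change of truth value between `j` and
  -- `suc j` is used later: levels of width `s` fit and those of width `s − 1` do not.
  first-true : {P : ℕ → Set} → Decidable P → ¬ P 0 → ∀ N → P N → ∃ λ j → ¬ P j × P (suc j)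
  first-true P? ¬P0 zero    PN = contradiction PN ¬P0
  first-true P? ¬P0 (suc N) PN with P? N
  ... | yes PN′ = first-true P? ¬P0 N PN′
  ... | no ¬PN′ = N , ¬PN′ , PN

  Σ< : (ℕ → ℕ) → ℕ → ℕ
  Σ< F zero    = 0
  Σ< F (suc n) = F n + Σ< F n

  sum-reverse : ∀ (F : ℕ → ℕ) n → sum {n} (λ v → F (n ∸ suc (toℕ v))) ≡ Σ< F n
  sum-reverse F zero    = refl
  sum-reverse F (suc n) = cong (F n +_) (sum-reverse F n)

  Σ<-zero : ∀ {F} n → (∀ p → p < n → F p ≡ 0) → Σ< F n ≡ 0
  Σ<-zero zero    _  = refl
  Σ<-zero (suc n) F0 = cong₂ _+_ (F0 n ≤-refl) (Σ<-zero n (λ p p<n → F0 p (m≤n⇒m≤1+n p<n)))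

  -- The term at 0 does not grow, so `c` is paid only `n` times for `n + 1` terms. This is what
  -- spares the vertex of degree `δ`.
  Σ<-jump : ∀ {F G} c n → F 0 ≤ G 0 → (∀ p → p < suc n → F p ≤ G p + c) → Σ< F (suc n) ≤ Σ< G (suc n) + n * c
  Σ<-jump c zero F0≤G0 _ = +-monoˡ-≤ 0 (≤-trans F0≤G0 (m≤m+n _ 0))
  Σ<-jump {F} {G} c (suc n) F0≤G0 F≤G = begin
    F (suc n) + Σ< F (suc n)
      ≤⟨ +-mono-≤ (F≤G (suc n) ≤-refl) (Σ<-jump {F} {G} c n F0≤G0 (λ p p<n → F≤G p (m≤n⇒m≤1+n p<n))) ⟩
    (G (suc n) + c) + (Σ< G (suc n) + n * c)
      ≡⟨ solve 4 (λ a c b d → (a :+ c) :+ (b :+ d)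
            := (a :+ b) :+ (c :+ d)) refl (G (suc n)) c (Σ< G (suc n)) (n * c) ⟩
    (G (suc n) + Σ< G (suc n)) + suc n * c ∎
    where
    open ≤-Reasoning
    open +-*-Solver

  sum-greedy : ∀ {n} c {E} → E ≤ n * c → sum {n} (λ v → c ⊓ (E ∸ toℕ v * c)) ≡ E
  sum-greedy {zero}  c         z≤n = refl
  sum-greedy {suc n} c {E} E≤ = begin
    c ⊓ E + sum {n} (λ v → c ⊓ (E ∸ (c + toℕ v * c)))
      ≡⟨ cong (c ⊓ E +_) (sum-cong-≗ (λ (v : Fin n) → cong (c ⊓_) (∸-+-assoc E c (toℕ v * c)))) ⟨
    c ⊓ E + sum {n} (λ v → c ⊓ (E ∸ c ∸ toℕ v * c))
      ≡⟨ cong (c ⊓ E +_) (sum-greedy {n} c (m≤n+o⇒m∸n≤o E c E≤)) ⟩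
    c ⊓ E + (E ∸ c)
      ≡⟨ m⊓n+n∸m≡n c E ⟩
    E ∎
    where open ≡-Reasoning

  -- Sums of the levels `⌊p/s⌋`

  Σ/ : (s n : ℕ) .{{_ : NonZero s}} → ℕ
  Σ/ s n = Σ< (_/ s) n

  module _ (s : ℕ) .{{_ : NonZero s}} where

    block-/ : ∀ t r → r < s → (t * s + r) / s ≡ t
    block-/ t r r<s = begin
      (t * s + r) / s   ≡⟨ +-distrib-/ (t * s) r (subst (_< s) (sym (cong₂ _+_ (m*n%n≡0 t s) (m<n⇒m%n≡m r<s))) r<s) ⟩
      t * s / s + r / s ≡⟨ cong₂ _+_ (m*n/n≡m t s) (m<n⇒m/n≡0 r<s) ⟩
      t + 0             ≡⟨ +-identityʳ t ⟩
      t                 ∎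
      where open ≡-Reasoning

    -- Below `t s + r`, the levels of the `t` full blocks fall short of `t` by `t, …, 1`, each `s`
    -- times, in all `s t (t + 1) / 2`. Allowing `r = s` lets the induction pass from the end of
    -- block `t` to the start of the next.
    Σ/-block : ∀ t r → r ≤ s → 2 * Σ/ s (t * s + r) + s * (t * suc t) ≡ 2 * (t * (t * s + r))
    Σ/-block zero    zero    _   = *-zeroʳ s
    Σ/-block (suc t) zero    _   = begin
      2 * Σ/ s (suc t * s + 0) + s * (suc t * suc (suc t))
        ≡⟨ cong (λ n → 2 * Σ/ s n + s * (suc t * suc (suc t))) n≡ ⟩
      2 * Σ/ s (t * s + s) + s * (suc t * suc (suc t))
        ≡⟨ solve 3 (λ L s t → con 2 :* L :+ s :* ((con 1 :+ t) :* (con 2 :+ t))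
              := con 2 :* L :+ s :* (t :* (con 1 :+ t)) :+ con 2 :* (t :* s :+ s)) refl (Σ/ s (t * s + s)) s t ⟩
      2 * Σ/ s (t * s + s) + s * (t * suc t) + 2 * (t * s + s)
        ≡⟨ cong (_+ 2 * (t * s + s)) (Σ/-block t s ≤-refl) ⟩
      2 * (t * (t * s + s)) + 2 * (t * s + s)
        ≡⟨ solve 2 (λ t s → con 2 :* (t :* (t :* s :+ s)) :+ con 2 :* (t :* s :+ s)
              := con 2 :* ((con 1 :+ t) :* (s :+ t :* s :+ con 0))) refl t s ⟩
      2 * (suc t * (suc t * s + 0)) ∎
      where
      open ≡-Reasoning
      open +-*-Solver
      n≡ : suc t * s + 0 ≡ t * s + s
      n≡ = trans (+-identityʳ _) (+-comm s (t * s))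
    Σ/-block t (suc r) r<s = begin
      2 * Σ/ s (t * s + suc r) + s * (t * suc t)
        ≡⟨ cong (λ n → 2 * Σ/ s n + s * (t * suc t)) (+-suc (t * s) r) ⟩
      2 * ((t * s + r) / s + Σ/ s (t * s + r)) + s * (t * suc t)
        ≡⟨ cong (λ q → 2 * (q + Σ/ s (t * s + r)) + s * (t * suc t)) (block-/ t r r<s) ⟩
      2 * (t + Σ/ s (t * s + r)) + s * (t * suc t)
        ≡⟨ solve 3 (λ t L X → con 2 :* (t :+ L) :+ X
              := con 2 :* t :+ (con 2 :* L :+ X)) refl t (Σ/ s (t * s + r)) (s * (t * suc t)) ⟩
      2 * t + (2 * Σ/ s (t * s + r) + s * (t * suc t))
        ≡⟨ cong (2 * t +_) (Σ/-block t r (<⇒≤ r<s)) ⟩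
      2 * t + 2 * (t * (t * s + r))
        ≡⟨ solve 2 (λ t X → con 2 :* t :+ con 2 :* (t :* X)
              := con 2 :* (t :* (con 1 :+ X))) refl t (t * s + r) ⟩
      2 * (t * suc (t * s + r))
        ≡⟨ cong (λ n → 2 * (t * n)) (+-suc (t * s) r) ⟨
      2 * (t * (t * s + suc r)) ∎
      where
      open ≡-Reasoning
      open +-*-Solver

    n≡block : ∀ n → n / s * s + n % s ≡ n
    n≡block n = trans (+-comm _ (n % s)) (sym (m≡m%n+[m/n]*n n s))

    Σ/-formula : ∀ n → 2 * Σ/ s n + s * (n / s * suc (n / s)) ≡ 2 * (n / s * n)
    Σ/-formula n = subst (λ x → 2 * Σ/ s x + s * (n / s * suc (n / s)) ≡ 2 * (n / s * x)) (n≡block n)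
      (Σ/-block (n / s) (n % s) (<⇒≤ (m%n<n n s)))

    -- In the formula `q s ≤ n` bounds `s q (q + 1)` by `n (q + 1)`; thus the average level is at
    -- least `(q − 1)/2`.
    Σ/-growth : ∀ n → n / s * n ≤ 2 * Σ/ s n + n
    Σ/-growth n = +-cancelʳ-≤ (q * n) _ _ (begin
      q * n + q * n                       ≡⟨ cong (q * n +_) (+-identityʳ (q * n)) ⟨
      2 * (q * n)                         ≡⟨ Σ/-formula n ⟨
      2 * Σ/ s n + s * (q * suc q)        ≡⟨ cong (2 * Σ/ s n +_) (solve 2 (λ s q → s :* (q :* (con 1 :+ q))
            := q :* s :* (con 1 :+ q)) refl s q) ⟩
      2 * Σ/ s n + q * s * suc q          ≤⟨ +-monoʳ-≤ (2 * Σ/ s n) (*-monoˡ-≤ (suc q) (m/n*n≤m n s)) ⟩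
      2 * Σ/ s n + n * suc q              ≡⟨ solve 3 (λ L n q → L :+ n :* (con 1 :+ q)
            := L :+ n :+ q :* n) refl (2 * Σ/ s n) n q ⟩
      2 * Σ/ s n + n + q * n              ∎)
      where
      open ≤-Reasoning
      open +-*-Solver
      q = n / s

    n<suc[n/s]*s : ∀ n → n < suc (n / s) * s
    n<suc[n/s]*s n = begin-strict
      n                    ≡⟨ m≡m%n+[m/n]*n n s ⟩
      n % s + n / s * s    <⟨ +-monoˡ-< (n / s * s) (m%n<n n s) ⟩
      suc (n / s) * s      ∎
      where open ≤-Reasoning

  -- Vertex v, counted from the top, has degree δ + h ⌊(n − 1 − v)/s⌋ plus an increment of at most 2h; the
  -- increments add up to E and fill the vertices from the top, so they respect the order.
  module Ladder (n s : ℕ) .{{_ : NonZero n}} .{{_ : NonZero s}} (δ k E : ℕ) (E≤ : E ≤ pred n * (2 * suc k)) where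

    h c : ℕ
    h = suc k
    c = 2 * h

    level increment : Fin n → ℕ
    level v     = (n ∸ suc (toℕ v)) / s
    increment v = c ⊓ (E ∸ toℕ v * c)

    ladder : Fin n → ℕ
    ladder v = δ + h * level v + increment v

    increment-antitone : ∀ {u v : Fin n} → toℕ u ≤ toℕ v → increment v ≤ increment u
    increment-antitone u≤v = ⊓-monoʳ-≤ c (∸-monoʳ-≤ E (*-monoˡ-≤ c u≤v))

    ladder-antitone : ∀ {u v} → toℕ u ≤ toℕ v → ladder v ≤ ladder u
    ladder-antitone {u} {v} u≤v = +-mono-≤
      (+-monoʳ-≤ δ (*-monoʳ-≤ h (/-monoˡ-≤ s (∸-monoʳ-≤ n (s≤s u≤v)))))
      (increment-antitone {u} {v} u≤v)

    δ≤ladder : ∀ v → δ ≤ ladder v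
    δ≤ladder v = ≤-trans (m≤m+n δ _) (m≤m+n _ (increment v))

    ladder≤ : ∀ v → ladder v ≤ δ + h * (n / s) + c
    ladder≤ v = +-mono-≤ (+-monoʳ-≤ δ (*-monoʳ-≤ h (/-monoˡ-≤ s (m∸n≤m n (suc (toℕ v)))))) (m⊓n≤m c _)

    -- Moving `s` places towards the top gains a whole level, worth `h`, and the antitone increments
    -- do not reduce this.
    ladder-separated : ∀ {u v} → toℕ u + s ≤ toℕ v → ladder v + h ≤ ladder u
    ladder-separated {u} {v} u+s≤v = begin
      δ + h * level v + increment v + h
        ≡⟨ solve 4 (λ δ h l i → δ :+ h :* l :+ i :+ h
              := δ :+ h :* (con 1 :+ l) :+ i) refl δ h (level v) (increment v) ⟩
      δ + h * suc (level v) + increment v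
        ≤⟨ +-mono-≤ (+-monoʳ-≤ δ (*-monoʳ-≤ h level-step)) (increment-antitone {u} {v} (≤-trans (m≤m+n (toℕ u) s) u+s≤v)) ⟩
      δ + h * level u + increment u ∎
      where
      open ≤-Reasoning
      open +-*-Solver
      room : n ∸ suc (toℕ v) ≤ n ∸ suc (toℕ u) ∸ s
      room = ≤-trans (∸-monoʳ-≤ n (s≤s u+s≤v)) (≤-reflexive (sym (∸-+-assoc n (suc (toℕ u)) s)))
      s≤ : s ≤ n ∸ suc (toℕ u)
      s≤ = m+n≤o⇒m≤o∸n s (≤-trans (≤-reflexive (trans (+-suc s (toℕ u)) (cong suc (+-comm s (toℕ u)))))
          (≤-trans (s≤s u+s≤v) (Fin.toℕ<n v)))
      level-step : suc (level v) ≤ level u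
      level-step = ≤-trans (s≤s (/-monoˡ-≤ s room)) (≤-reflexive (sym (m/n≡1+[m∸n]/n s≤)))

    sum-ladder : sum ladder ≡ n * δ + h * Σ/ s n + E
    sum-ladder = begin
      sum ladder
        ≡⟨ ∑-distrib-+ (λ v → δ + h * level v) increment ⟩
      sum (λ v → δ + h * level v) + sum increment
        ≡⟨ cong₂ _+_ (∑-distrib-+ (λ _ → δ) (λ v → h * level v)) (sum-greedy {n} c (≤-trans E≤ (*-monoˡ-≤ c (pred[n]≤n {n})))) ⟩
      sum {n} (λ _ → δ) + sum (λ v → h * level v) + E
        ≡⟨ cong (_+ E) (cong₂ _+_ (sum-const n δ) (trans (sym (*-distribˡ-sum h level)) (cong (h *_) (sum-reverse (_/ s) n)))) ⟩
      n * δ + h * Σ/ s n + E ∎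
      where open ≡-Reasoning

    last-vertex : Fin n
    last-vertex = Fin.fromℕ< (≤-reflexive (suc-pred n))

    -- The portions of the first `n − 1` vertices exhaust `E`, so the last one gets nothing beyond
    -- `δ`.
    ladder-last : ladder last-vertex ≡ δ
    ladder-last = begin
      ladder last-vertex
        ≡⟨ cong (λ v → δ + h * ((n ∸ suc v) / s) + c ⊓ (E ∸ v * c)) (Fin.toℕ-fromℕ< _) ⟩
      δ + h * ((n ∸ suc (pred n)) / s) + c ⊓ (E ∸ pred n * c)
        ≡⟨ cong₂ (λ x y → δ + h * (x / s) + c ⊓ y) (m≤n⇒m∸n≡0 (≤-reflexive (sym (suc-pred n)))) (m≤n⇒m∸n≡0 E≤) ⟩
      δ + h * (0 / s) + c ⊓ 0
        ≡⟨ cong₂ (λ x y → δ + h * x + y) (0/n≡0 s) (⊓-zeroʳ c) ⟩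
      δ + h * 0 + 0
        ≡⟨ solve 2 (λ δ h → δ :+ h :* con 0 :+ con 0 := δ) refl δ h ⟩
      δ ∎
      where
      open ≡-Reasoning
      open +-*-Solver

  -- The choice of `s`, the optimal graph and the optimal `t`

  module Construction (n m δ k N : ℕ) .{{_ : NonZero n}} .{{_ : NonZero δ}} (N+δn≡2m : N + δ * n ≡ 2 * m)
    -- The hypotheses on `n` without rationals, their premises multiplied by `n` and `h n`:
    -- `y ≤ 2d + 5h + 1` yields `y² ≤ 4δn`, and `y ≤ 2x + 3` yields `y² ≤ n`.
    (square≤4δn : ∀ y → y * n ≤ 2 * (2 * m) + 5 * suc k * n + n → y * y ≤ 4 * (δ * n))
    (square≤n   : ∀ y → y * (suc k * n) ≤ 2 * N + 3 * (suc k * n) → y * y ≤ n) where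

    h : ℕ
    h = suc k

    Fits : (s : ℕ) .{{_ : NonZero s}} → Set
    Fits s = h * Σ/ s n ≤ N

    -- This is `q ≤ 2x + 1` multiplied by `h n`.
    levels-bound : ∀ s .{{_ : NonZero s}} → Fits s → n / s * (h * n) ≤ 2 * N + h * n
    levels-bound s fits = begin
      n / s * (h * n)               ≡⟨ solve 3 (λ q h n → q :* (h :* n) := h :* (q :* n)) refl (n / s) h n ⟩
      h * (n / s * n)               ≤⟨ *-monoʳ-≤ h (Σ/-growth s n) ⟩
      h * (2 * Σ/ s n + n)          ≡⟨ solve 3 (λ h L n → h :* (con 2 :* L :+ n)
            := con 2 :* (h :* L) :+ h :* n) refl h (Σ/ s n) n ⟩
      2 * (h * Σ/ s n) + h * n      ≤⟨ +-monoˡ-≤ (h * n) (*-monoʳ-≤ 2 fits) ⟩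
      2 * N + h * n                 ∎
      where
      open ≤-Reasoning
      open +-*-Solver

    few-levels : ∀ s .{{_ : NonZero s}} → Fits s → (2 + n / s) * (2 + n / s) ≤ n
    few-levels s fits = square≤n (2 + n / s) (begin
      (2 + n / s) * (h * n)             ≡⟨ *-distribʳ-+ (h * n) 2 (n / s) ⟩
      2 * (h * n) + n / s * (h * n)     ≤⟨ +-monoʳ-≤ (2 * (h * n)) (levels-bound s fits) ⟩
      2 * (h * n) + (2 * N + h * n)     ≡⟨ solve 2 (λ x N → con 2 :* x :+ (con 2 :* N :+ x)
            := con 2 :* N :+ con 3 :* x) refl (h * n) N ⟩
      2 * N + 3 * (h * n)               ∎)
      where
      open ≤-Reasoning
      open +-*-Solver

    -- For `s = 1` there would be `n` levels and `(n + 2)² ≤ n`. Hence `s ≥ 2`, and `s′ = s − 1` is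
    -- a legitimate divisor.
    one-misfits : ¬ Fits 1
    one-misfits fits = <⇒≱ (<-≤-trans (m<n+m n {2} (s≤s z≤n)) (m≤m*n (2 + n) (2 + n)))
      (subst (λ q → (2 + q) * (2 + q) ≤ n) (n/1≡n n) (few-levels 1 fits))

    large-fits : Fits (suc n)
    large-fits = ≤-trans (≤-reflexive (trans (cong (h *_) (Σ<-zero n (λ p p<n → m<n⇒m/n≡0 (m≤n⇒m≤1+n p<n)))) (*-zeroʳ h))) z≤n

    threshold : ∃ λ j → ¬ Fits (suc j) × Fits (suc (suc j))
    threshold = first-true {P = λ j → Fits (suc j)} (λ j → h * Σ/ (suc j) n ≤? N) one-misfits n large-fits

    s′ s q : ℕ
    s′ = suc (proj₁ threshold)
    s  = suc s′
    q  = n / s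

    misfit : N < h * Σ/ s′ n
    misfit = ≰⇒> (proj₁ (proj₂ threshold))

    fit : Fits s
    fit = proj₂ (proj₂ threshold)

    -- Otherwise `2n < 2(q + 1)s = (q + 1)(2 + 2s′) ≤ (q + 2)² ≤ n`.
    q<2s′ : q < 2 * s′
    q<2s′ = ≰⇒> λ 2s′≤q → <⇒≱ (begin-strict
      n + n                        <⟨ +-mono-< (n<suc[n/s]*s s n) (n<suc[n/s]*s s n) ⟩
      suc q * s + suc q * s        ≡⟨ solve 2 (λ a s′ → a :* (con 1 :+ s′) :+ a :* (con 1 :+ s′)
            := a :* (con 2 :+ con 2 :* s′)) refl (suc q) s′ ⟩
      suc q * (2 + 2 * s′)         ≤⟨ *-mono-≤ (n≤1+n (suc q)) (+-monoʳ-≤ 2 2s′≤q) ⟩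
      (2 + q) * (2 + q)            ≤⟨ few-levels s fit ⟩
      n                            ∎) (m≤m+n n n)
      where
      open ≤-Reasoning
      open +-*-Solver

    -- With `i = ⌊p/s⌋` one has `p < (i + 1)s = (i + 1)s′ + (i + 1)`, and `i + 1 ≤ q + 1 ≤ 2s′`
    -- gives `p < (i + 3)s′`.
    level-jump : ∀ p → p < n → p / s′ ≤ p / s + 2
    level-jump p p<n = s≤s⁻¹ (m<n*o⇒m/o<n (begin-strict
      p                            <⟨ n<suc[n/s]*s s p ⟩
      suc i * suc s′               ≡⟨ *-suc (suc i) s′ ⟩
      suc i + suc i * s′           ≤⟨ +-monoˡ-≤ (suc i * s′) (≤-trans (s≤s (/-monoˡ-≤ s (<⇒≤ p<n))) q<2s′) ⟩
      2 * s′ + suc i * s′          ≡⟨ solve 2 (λ s i → con 2 :* s :+ (con 1 :+ i) :* s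
            := (con 1 :+ (i :+ con 2)) :* s) refl s′ i ⟩
      suc (i + 2) * s′             ∎))
      where
      open ≤-Reasoning
      open +-*-Solver
      i = p / s

    Σ/-jump : Σ/ s′ n ≤ Σ/ s n + pred n * 2
    Σ/-jump = subst (λ x → Σ/ s′ x ≤ Σ/ s x + pred n * 2) (suc-pred n)
      (Σ<-jump {_/ s′} {_/ s} 2 (pred n) (≤-trans (≤-reflexive (0/n≡0 s′)) z≤n)
        (λ p p< → level-jump p (subst (p <_) (suc-pred n) p<)))

    E : ℕ
    E = N ∸ h * Σ/ s n

    E≤ : E ≤ pred n * (2 * h)
    E≤ = m≤n+o⇒m∸n≤o N (h * Σ/ s n) (begin
      N                                     ≤⟨ <⇒≤ misfit ⟩
      h * Σ/ s′ n                           ≤⟨ *-monoʳ-≤ h Σ/-jump ⟩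
      h * (Σ/ s n + pred n * 2)             ≡⟨ solve 3 (λ h L x → h :* (L :+ x :* con 2)
            := h :* L :+ x :* (con 2 :* h)) refl h (Σ/ s n) (pred n) ⟩
      h * Σ/ s n + pred n * (2 * h)         ∎)
      where
      open ≤-Reasoning
      open +-*-Solver

    open Ladder n s δ k E E≤ hiding (h)

    sum-ladder≡m+m : sum ladder ≡ m + m
    sum-ladder≡m+m = begin
      sum ladder                                 ≡⟨ sum-ladder ⟩
      n * δ + h * Σ/ s n + E                     ≡⟨ +-assoc (n * δ) _ E ⟩
      n * δ + (h * Σ/ s n + E)                   ≡⟨ cong₂ _+_ (*-comm n δ) (m+[n∸m]≡n fit) ⟩
      δ * n + N                                  ≡⟨ trans (+-comm (δ * n) N) N+δn≡2m ⟩
      2 * m                                      ≡⟨ cong (m +_) (+-identityʳ m) ⟩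
      m + m                                      ∎
      where open ≡-Reasoning

    A : ℕ
    A = δ + h * q + c

    [A+δ+1]²≤4δn : (A + δ + 1) * (A + δ + 1) ≤ 4 * (δ * n)
    [A+δ+1]²≤4δn = square≤4δn (A + δ + 1) (begin
      (A + δ + 1) * n
        ≡⟨ solve 4 (λ δ h q n → (δ :+ h :* q :+ con 2 :* h :+ δ :+ con 1) :* n
                      := q :* (h :* n) :+ (con 2 :* (δ :* n) :+ con 2 :* (h :* n) :+ n)) refl δ h q n ⟩
      q * (h * n) + (2 * (δ * n) + 2 * (h * n) + n)
        ≤⟨ +-monoˡ-≤ _ (levels-bound s fit) ⟩
      2 * N + h * n + (2 * (δ * n) + 2 * (h * n) + n)
        -- The estimate has reached `2d + 3h + 1`, times `n`; another `2h` brings it to the `5h` of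
        -- the hypothesis.
        ≤⟨ m≤m+n _ (2 * (h * n)) ⟩
      2 * N + h * n + (2 * (δ * n) + 2 * (h * n) + n) + 2 * (h * n)
        ≡⟨ solve 4 (λ N δn h n → con 2 :* N :+ h :* n :+ (con 2 :* δn :+ con 2 :* (h :* n) :+ n) :+ con 2 :* (h :* n)
                      := con 2 :* (N :+ δn) :+ con 5 :* h :* n :+ n) refl N (δ * n) h n ⟩
      2 * (N + δ * n) + 5 * h * n + n
        ≡⟨ cong (λ x → 2 * x + 5 * h * n + n) N+δn≡2m ⟩
      2 * (2 * m) + 5 * h * n + n ∎)
      where
      open ≤-Reasoning
      open +-*-Solver

    optimal : Σ (Graph n) λ G → edgeCount G ≡ m × minDegree G ≡ δ × sp G k ≤ s
    optimal =
      let G , deg≡ = zverovich {A = A} {m = m} ladder (λ {x} {y} → ladder-antitone {x} {y}) δ≤ladder ladder≤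
                       sum-ladder≡m+m [A+δ+1]²≤4δn
          degree≡ = λ v → trans (degree≡deg G v) (deg≡ v)
      in G
       , double-injective (trans (sym (handshake G)) (trans (sum-cong-≗ deg≡) sum-ladder≡m+m))
       , minDegree≡ G (λ v → subst (δ ≤_) (sym (degree≡ v)) (δ≤ladder v)) last-vertex (trans (degree≡ last-vertex) ladder-last)
       , sp≤-separated G k s (λ {u} {v} u+s≤v →
           subst₂ (λ a b → a + h ≤ b) (sym (degree≡ v)) (sym (degree≡ u)) (ladder-separated {u} {v} u+s≤v))

    t : ℕ
    t = n / s′

    -- For `t = 0` all levels for `s′` would vanish, and their sum could not exceed `N`.
    t≢0 : NonZero t
    t≢0 = ≢-nonZero λ t≡0 → n≮0 (subst (N <_) (trans (cong (h *_) (Σ/≡0 t≡0)) (*-zeroʳ h)) misfit)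
      where
      Σ/≡0 : t ≡ 0 → Σ/ s′ n ≡ 0
      Σ/≡0 t≡0 = m+n≡0⇒m≡0 _ (m+n≡0⇒m≡0 (2 * Σ/ s′ n)
        (trans (Σ/-formula s′ n) (cong (λ x → 2 * (x * n)) t≡0)))

    -- This is `f_t > s′` cleared of its denominator. `Σ/-formula` expresses the level sum for `s′`
    -- exactly through this `t`, so the inequality is `misfit` rewritten.
    t-witness : 2 * (m + m) + h * (s′ * (t * suc t)) < 2 * (n * (δ + t * h))
    t-witness = begin-strict
      2 * (m + m) + h * (s′ * (t * suc t))
        ≡⟨ cong (λ x → 2 * x + h * (s′ * (t * suc t))) (trans N+δn≡2m (cong (m +_) (+-identityʳ m))) ⟨
      2 * (N + δ * n) + h * (s′ * (t * suc t))
        <⟨ +-monoˡ-< _ (*-monoʳ-< 2 (+-monoˡ-< (δ * n) misfit)) ⟩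
      2 * (h * Σ/ s′ n + δ * n) + h * (s′ * (t * suc t))
        ≡⟨ solve 4 (λ h L x y → con 2 :* (h :* L :+ x) :+ h :* y
              := con 2 :* x :+ h :* (con 2 :* L :+ y)) refl h (Σ/ s′ n) (δ * n) (s′ * (t * suc t)) ⟩
      2 * (δ * n) + h * (2 * Σ/ s′ n + s′ * (t * suc t))
        ≡⟨ cong (λ x → 2 * (δ * n) + h * x) (Σ/-formula s′ n) ⟩
      2 * (δ * n) + h * (2 * (t * n))
        ≡⟨ solve 4 (λ δ n h t → con 2 :* (δ :* n) :+ h :* (con 2 :* (t :* n))
              := con 2 :* (n :* (δ :+ t :* h))) refl δ n h t ⟩
      2 * (n * (δ + t * h)) ∎
      where
      open ≤-Reasoning
      open +-*-Solver

-- From rationals and ceilings to inequalities of natural numbers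

module Arithmetic where

  open import Defs hiding (sym)
  open import Data.Integer as ℤ using (ℤ; +_)
  import Data.Integer.DivMod as ℤ
  import Data.Integer.Properties as ℤ
  import Data.Integer.Solver as ℤ
  open import Data.Nat as ℕ using (ℕ; suc; NonZero)
  import Data.Nat.Properties as ℕ
  open import Data.Nat.Properties using (m*n≢0)
  import Data.Nat.Solver as ℕ
  open import Data.Rational hiding (NonZero)
  open import Data.Rational.Properties
  open import Data.Rational.Solver using (module +-*-Solver)
  import Data.Rational.Unnormalised as ℚᵘ
  import Data.Rational.Unnormalised.Properties as ℚᵘ
  open import Relation.Binary.PropositionalEquality

  -- `_/_` reduces to lowest terms; cross-multiplication is therefore done on unnormalised
  -- fractions, which keep numerator and denominator as written.
  toℚᵘ-/ : ∀ i n .{{_ : NonZero n}} → toℚᵘ (i / n) ℚᵘ.≃ i ℚᵘ./ n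
  toℚᵘ-/ i (suc n) = toℚᵘ-fromℚᵘ (i ℚᵘ./ suc n)

  /-≤⁻ : ∀ i m j n .{{_ : NonZero m}} .{{_ : NonZero n}} → i / m ≤ j / n → i ℤ.* + n ℤ.≤ j ℤ.* + m
  /-≤⁻ i m@(suc _) j n@(suc _) le = ℚᵘ.drop-*≤* (begin
    i ℚᵘ./ m        ≃⟨ toℚᵘ-/ i m ⟨
    toℚᵘ (i / m)    ≤⟨ toℚᵘ-mono-≤ le ⟩
    toℚᵘ (j / n)    ≃⟨ toℚᵘ-/ j n ⟩
    j ℚᵘ./ n        ∎)
    where open ℚᵘ.≤-Reasoning

  /-≤⁺ : ∀ i m j n .{{_ : NonZero m}} .{{_ : NonZero n}} → i ℤ.* + n ℤ.≤ j ℤ.* + m → i / m ≤ j / n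
  /-≤⁺ i m@(suc _) j n@(suc _) le = toℚᵘ-cancel-≤ (begin
    toℚᵘ (i / m)    ≃⟨ toℚᵘ-/ i m ⟩
    i ℚᵘ./ m        ≤⟨ ℚᵘ.*≤* le ⟩
    j ℚᵘ./ n        ≃⟨ toℚᵘ-/ j n ⟨
    toℚᵘ (j / n)    ∎)
    where open ℚᵘ.≤-Reasoning

  fromℕ-cancel-≤ : ∀ {a b} → fromℕ a ≤ fromℕ b → a ℕ.≤ b
  fromℕ-cancel-≤ {a} {b} le = ℤ.drop‿+≤+ (subst₂ ℤ._≤_ (ℤ.*-identityʳ (+ a)) (ℤ.*-identityʳ (+ b)) (/-≤⁻ (+ a) 1 (+ b) 1 le))

  fromℕ-mono-≤ : ∀ {a b} → a ℕ.≤ b → fromℕ a ≤ fromℕ b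
  fromℕ-mono-≤ {a} {b} le = /-≤⁺ (+ a) 1 (+ b) 1 (ℤ.*-monoʳ-≤-nonNeg (+ 1) (ℤ.+≤+ le))

  toℚᵘ-fromℕ : ∀ a → toℚᵘ (fromℕ a) ℚᵘ.≃ + a ℚᵘ./ 1
  toℚᵘ-fromℕ a = toℚᵘ-/ (+ a) 1

  fromℕ-+ : ∀ a b → fromℕ (a ℕ.+ b) ≡ fromℕ a + fromℕ b
  fromℕ-+ a b = toℚᵘ-injective (begin
    toℚᵘ (fromℕ (a ℕ.+ b))              ≈⟨ toℚᵘ-fromℕ (a ℕ.+ b) ⟩
    + (a ℕ.+ b) ℚᵘ./ 1                  ≈⟨ ℚᵘ.*≡* (cong (ℤ._* + 1) (sym (cong₂ ℤ._+_ (ℤ.*-identityʳ (+ a)) (ℤ.*-identityʳ (+ b))))) ⟩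
    (+ a ℚᵘ./ 1) ℚᵘ.+ (+ b ℚᵘ./ 1)      ≈⟨ ℚᵘ.+-cong (toℚᵘ-fromℕ a) (toℚᵘ-fromℕ b) ⟨
    toℚᵘ (fromℕ a) ℚᵘ.+ toℚᵘ (fromℕ b)  ≈⟨ toℚᵘ-homo-+ (fromℕ a) (fromℕ b) ⟨
    toℚᵘ (fromℕ a + fromℕ b)            ∎)
    where open ℚᵘ.≃-Reasoning

  fromℕ-* : ∀ a b → fromℕ (a ℕ.* b) ≡ fromℕ a * fromℕ b
  fromℕ-* a b = toℚᵘ-injective (begin
    toℚᵘ (fromℕ (a ℕ.* b))              ≈⟨ toℚᵘ-fromℕ (a ℕ.* b) ⟩
    + (a ℕ.* b) ℚᵘ./ 1                  ≈⟨ ℚᵘ.*≡* (cong (ℤ._* + 1) (ℤ.pos-* a b)) ⟩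
    (+ a ℚᵘ./ 1) ℚᵘ.* (+ b ℚᵘ./ 1)      ≈⟨ ℚᵘ.*-cong (toℚᵘ-fromℕ a) (toℚᵘ-fromℕ b) ⟨
    toℚᵘ (fromℕ a) ℚᵘ.* toℚᵘ (fromℕ b)  ≈⟨ toℚᵘ-homo-* (fromℕ a) (fromℕ b) ⟨
    toℚᵘ (fromℕ a * fromℕ b)            ∎)
    where open ℚᵘ.≃-Reasoning

  fromℕ-nonNeg : ∀ a → NonNegative (fromℕ a)
  fromℕ-nonNeg a = normalize-nonNeg a 1

  fromℕ-pos : ∀ a .{{_ : NonZero a}} → Positive (fromℕ a)
  fromℕ-pos a = normalize-pos a 1

  /*fromℕ : ∀ a n .{{_ : NonZero n}} → (+ a / n) * fromℕ n ≡ fromℕ a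
  /*fromℕ a n@(suc _) = toℚᵘ-injective (begin
    toℚᵘ ((+ a / n) * fromℕ n)            ≈⟨ toℚᵘ-homo-* (+ a / n) (fromℕ n) ⟩
    toℚᵘ (+ a / n) ℚᵘ.* toℚᵘ (fromℕ n)    ≈⟨ ℚᵘ.*-cong (toℚᵘ-/ (+ a) n) (toℚᵘ-fromℕ n) ⟩
    (+ a ℚᵘ./ n) ℚᵘ.* (+ n ℚᵘ./ 1)           ≈⟨ ℚᵘ.*≡* (ℤ.*-assoc (+ a) (+ n) (+ 1)) ⟩
    + a ℚᵘ./ 1                            ≈⟨ toℚᵘ-fromℕ a ⟨
    toℚᵘ (fromℕ a)                        ∎)
    where open ℚᵘ.≃-Reasoning

  /ℕ*fromℕ : ∀ q i .{{_ : NonZero i}} → (q /ℕ i) * fromℕ i ≡ q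
  /ℕ*fromℕ q i = trans (*-assoc q _ _) (trans (cong (q *_) (/*fromℕ 1 i)) (*-identityʳ q))

  /ℕ-≤ : ∀ {q r} i .{{_ : NonZero i}} → q /ℕ i ≤ r → q ≤ r * fromℕ i
  /ℕ-≤ {q} {r} i le = subst (_≤ r * fromℕ i) (/ℕ*fromℕ q i) (*-monoʳ-≤-nonNeg (fromℕ i) {{fromℕ-nonNeg i}} le)

  square-mono : ∀ a {q} → fromℕ a ≤ q → fromℕ (a ℕ.* a) ≤ square q
  square-mono a {q} a≤q = begin
    fromℕ (a ℕ.* a)    ≡⟨ fromℕ-* a a ⟩
    fromℕ a * fromℕ a  ≤⟨ *-monoʳ-≤-nonNeg (fromℕ a) a≤q ⟩
    q * fromℕ a        ≤⟨ *-monoˡ-≤-nonNeg q a≤q ⟩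
    q * q              ∎
    where
    open ≤-Reasoning
    instance
      _ = fromℕ-nonNeg a
      _ = nonNegative (≤-trans (nonNegative⁻¹ (fromℕ a)) a≤q)

  -- The hypotheses on `d` and `n`, cleared of denominators

  module Hypotheses (n m δ h : ℕ) .{{_ : NonZero n}} .{{_ : NonZero δ}} .{{_ : NonZero h}} where

    d x degreeBound squareBound : ℚ
    d = + (2 ℕ.* m) / n
    x = (d - fromℕ δ) /ℕ h
    degreeBound = _/ℕ_ (square (fromℕ 2 * d + fromℕ 5 * fromℕ h + fromℕ 1)) (4 ℕ.* δ) {{m*n≢0 4 δ}}
    squareBound = square (fromℕ 2 * x + fromℕ 3)

    d*n : d * fromℕ n ≡ fromℕ (2 ℕ.* m)
    d*n = /*fromℕ (2 ℕ.* m) n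

    δn≤2m : fromℕ δ ≤ d → δ ℕ.* n ℕ.≤ 2 ℕ.* m
    δn≤2m δ≤d = fromℕ-cancel-≤ (begin
      fromℕ (δ ℕ.* n)     ≡⟨ fromℕ-* δ n ⟩
      fromℕ δ * fromℕ n   ≤⟨ *-monoʳ-≤-nonNeg (fromℕ n) {{fromℕ-nonNeg n}} δ≤d ⟩
      d * fromℕ n         ≡⟨ d*n ⟩
      fromℕ (2 ℕ.* m)     ∎)
      where open ≤-Reasoning

    square≤4δn : degreeBound ⊔ squareBound ≤ fromℕ n →
                 ∀ y → y ℕ.* n ℕ.≤ 2 ℕ.* (2 ℕ.* m) ℕ.+ 5 ℕ.* h ℕ.* n ℕ.+ n → y ℕ.* y ℕ.≤ 4 ℕ.* (δ ℕ.* n)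
    square≤4δn large y yn≤ = fromℕ-cancel-≤ (begin
      fromℕ (y ℕ.* y)               ≤⟨ square-mono y y≤q ⟩
      square q                      ≤⟨ /ℕ-≤ (4 ℕ.* δ) {{m*n≢0 4 δ}} (≤-trans (p≤p⊔q degreeBound squareBound) large) ⟩
      fromℕ n * fromℕ (4 ℕ.* δ)     ≡⟨ fromℕ-* n (4 ℕ.* δ) ⟨
      fromℕ (n ℕ.* (4 ℕ.* δ))       ≡⟨ cong fromℕ (trans (ℕ.*-comm n _) (ℕ.*-assoc 4 δ n)) ⟩
      fromℕ (4 ℕ.* (δ ℕ.* n))       ∎)
      where
      open ≤-Reasoning
      q = fromℕ 2 * d + fromℕ 5 * fromℕ h + fromℕ 1
      expand : fromℕ (2 ℕ.* (2 ℕ.* m) ℕ.+ 5 ℕ.* h ℕ.* n ℕ.+ n) ≡ q * fromℕ n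
      expand = begin-equality
        fromℕ (2 ℕ.* (2 ℕ.* m) ℕ.+ 5 ℕ.* h ℕ.* n ℕ.+ n)
          ≡⟨ trans (fromℕ-+ (2 ℕ.* (2 ℕ.* m) ℕ.+ 5 ℕ.* h ℕ.* n) n) (cong (_+ fromℕ n) (trans (fromℕ-+ (2 ℕ.* (2 ℕ.* m)) _)
               (cong₂ _+_ (trans (fromℕ-* 2 (2 ℕ.* m)) (cong (fromℕ 2 *_) (sym d*n)))
                          (trans (fromℕ-* (5 ℕ.* h) n) (cong (_* fromℕ n) (fromℕ-* 5 h)))))) ⟩
        fromℕ 2 * (d * fromℕ n) + fromℕ 5 * fromℕ h * fromℕ n + fromℕ n
          ≡⟨ solve 5 (λ a d b h n → a :* (d :* n) :+ b :* h :* n :+ n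
                := (a :* d :+ b :* h :+ con 1ℚ) :* n) refl (fromℕ 2) d (fromℕ 5) (fromℕ h) (fromℕ n) ⟩
        q * fromℕ n ∎
        where open +-*-Solver
      y≤q : fromℕ y ≤ q
      y≤q = *-cancelʳ-≤-pos (fromℕ n) {{fromℕ-pos n}} (begin
        fromℕ y * fromℕ n   ≡⟨ fromℕ-* y n ⟨
        fromℕ (y ℕ.* n)     ≤⟨ fromℕ-mono-≤ yn≤ ⟩
        fromℕ (2 ℕ.* (2 ℕ.* m) ℕ.+ 5 ℕ.* h ℕ.* n ℕ.+ n) ≡⟨ expand ⟩
        q * fromℕ n         ∎)

    square≤n : degreeBound ⊔ squareBound ≤ fromℕ n →
               ∀ N → N ℕ.+ δ ℕ.* n ≡ 2 ℕ.* m →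
               ∀ y → y ℕ.* (h ℕ.* n) ℕ.≤ 2 ℕ.* N ℕ.+ 3 ℕ.* (h ℕ.* n) → y ℕ.* y ℕ.≤ n
    square≤n large N N+δn≡2m y yhn≤ = fromℕ-cancel-≤
      (≤-trans (square-mono y y≤q) (≤-trans (p≤q⊔p degreeBound squareBound) large))
      where
      q = fromℕ 2 * x + fromℕ 3
      xhn : x * fromℕ (h ℕ.* n) ≡ fromℕ N
      xhn = begin
        x * fromℕ (h ℕ.* n)                          ≡⟨ cong (x *_) (fromℕ-* h n) ⟩
        x * (fromℕ h * fromℕ n)                      ≡⟨ *-assoc x (fromℕ h) (fromℕ n) ⟨
        x * fromℕ h * fromℕ n                        ≡⟨ cong (_* fromℕ n) (/ℕ*fromℕ (d - fromℕ δ) h) ⟩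
        (d - fromℕ δ) * fromℕ n                      ≡⟨ solve 3 (λ d δ n → (d :- δ) :* n
              := d :* n :- δ :* n) refl d (fromℕ δ) (fromℕ n) ⟩
        d * fromℕ n - fromℕ δ * fromℕ n              ≡⟨ cong₂ _-_ (trans d*n (cong fromℕ (sym N+δn≡2m))) (sym (fromℕ-* δ n)) ⟩
        fromℕ (N ℕ.+ δ ℕ.* n) - fromℕ (δ ℕ.* n)      ≡⟨ cong (_- fromℕ (δ ℕ.* n)) (fromℕ-+ N (δ ℕ.* n)) ⟩
        fromℕ N + fromℕ (δ ℕ.* n) - fromℕ (δ ℕ.* n)  ≡⟨ solve 2 (λ a b → a :+ b :- b
              := a) refl (fromℕ N) (fromℕ (δ ℕ.* n)) ⟩
        fromℕ N                                      ∎
        where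
        open ≡-Reasoning
        open +-*-Solver
      open ≤-Reasoning
      y≤q : fromℕ y ≤ q
      y≤q = *-cancelʳ-≤-pos (fromℕ (h ℕ.* n)) {{fromℕ-pos (h ℕ.* n) {{m*n≢0 h n}}}} (begin
        fromℕ y * fromℕ (h ℕ.* n)                        ≡⟨ fromℕ-* y (h ℕ.* n) ⟨
        fromℕ (y ℕ.* (h ℕ.* n))                          ≤⟨ fromℕ-mono-≤ yhn≤ ⟩
        fromℕ (2 ℕ.* N ℕ.+ 3 ℕ.* (h ℕ.* n))              ≡⟨ trans (fromℕ-+ (2 ℕ.* N) _) (cong₂ _+_ (fromℕ-* 2 N) (fromℕ-* 3 (h ℕ.* n))) ⟩
        fromℕ 2 * fromℕ N + fromℕ 3 * fromℕ (h ℕ.* n)    ≡⟨ cong (λ z → fromℕ 2 * z + fromℕ 3 * fromℕ (h ℕ.* n)) xhn ⟨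
        fromℕ 2 * (x * fromℕ (h ℕ.* n)) + fromℕ 3 * fromℕ (h ℕ.* n)
          ≡⟨ solve 4 (λ a x n b → a :* (x :* n) :+ b :* n
                := (a :* x :+ b) :* n) refl (fromℕ 2) x (fromℕ (h ℕ.* n)) (fromℕ 3) ⟩
        q * fromℕ (h ℕ.* n)                              ∎)
        where open +-*-Solver

  -- Floors, ceilings and `f_t`

  ≤-/ℕ⁺ : ∀ {i a} d .{{_ : NonZero d}} → i ℤ.* + d ℤ.≤ a → i ℤ.≤ a ℤ./ℕ d
  ≤-/ℕ⁺ {i} {a} d id≤a = subst (i ℤ.≤_) (ℤ.pred-suc (a ℤ./ℕ d))
    (ℤ.i<j⇒i≤pred[j] {i} {ℤ.suc (a ℤ./ℕ d)} (ℤ.*-cancelʳ-<-nonNeg (+ d) (ℤ.≤-<-trans id≤a (ℤ.n<s[n/ℕd]*d a d))))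

  ≤-/ℕ⁻ : ∀ {i a} d .{{_ : NonZero d}} → i ℤ.≤ a ℤ./ℕ d → i ℤ.* + d ℤ.≤ a
  ≤-/ℕ⁻ {i} {a} d i≤ = ℤ.≤-trans (ℤ.*-monoʳ-≤-nonNeg (+ d) i≤) (ℤ.[n/ℕd]*d≤n a d)

  -- `ceiling` goes through the floor of `- p`, and negation of a rational computes only once the
  -- sign of its numerator is known.
  ceiling≡ : ∀ p → ceiling p ≡ ℤ.- ((ℤ.- ↥ p) ℤ./ℕ ↧ₙ p)
  ceiling≡ (mkℚ ℤ.-[1+ a ] d _) = cong ℤ.-_ (ℤ.div-pos-is-/ℕ ℤ.+[1+ a ] (suc d))
  ceiling≡ (mkℚ ℤ.+0       d _) = cong ℤ.-_ (ℤ.div-pos-is-/ℕ ℤ.+0 (suc d))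
  ceiling≡ (mkℚ ℤ.+[1+ a ] d _) = cong ℤ.-_ (ℤ.div-pos-is-/ℕ ℤ.-[1+ a ] (suc d))

  ceiling-≤⁺ : ∀ p i → p ≤ i / 1 → ceiling p ℤ.≤ i
  ceiling-≤⁺ p i p≤i = subst₂ ℤ._≤_ (sym (ceiling≡ p)) (ℤ.neg-involutive i) (ℤ.neg-mono-≤ (≤-/ℕ⁺ (↧ₙ p)
    (subst (ℤ._≤ (ℤ.- ↥ p)) (ℤ.neg-distribˡ-* i (↧ p)) (ℤ.neg-mono-≤ ↥≤))))
    where
    ↥≤ : ↥ p ℤ.≤ i ℤ.* ↧ p
    ↥≤ = subst (ℤ._≤ i ℤ.* ↧ p) (ℤ.*-identityʳ (↥ p)) (/-≤⁻ (↥ p) (↧ₙ p) i 1 (subst (_≤ i / 1) (sym (↥p/↧p≡p p)) p≤i))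

  ceiling-≤⁻ : ∀ p i → ceiling p ℤ.≤ i → p ≤ i / 1
  ceiling-≤⁻ p i le = subst (_≤ i / 1) (↥p/↧p≡p p)
    (/-≤⁺ (↥ p) (↧ₙ p) i 1 (subst (ℤ._≤ i ℤ.* ↧ p) (sym (ℤ.*-identityʳ (↥ p))) ↥≤))
    where
    ↥≤ : ↥ p ℤ.≤ i ℤ.* ↧ p
    ↥≤ = ℤ.neg-cancel-≤ (subst (ℤ._≤ (ℤ.- ↥ p)) (sym (ℤ.neg-distribˡ-* i (↧ p))) (≤-/ℕ⁻ (↧ₙ p)
      (subst (ℤ.- i ℤ.≤_) (ℤ.neg-involutive _) (ℤ.neg-mono-≤ (subst (ℤ._≤ i) (ceiling≡ p) le)))))

  module _ (n m δ k t r : ℕ) .{{t≢0 : NonZero t}} where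

    private
      h D a b : ℕ
      h = suc k
      D = h ℕ.* (t ℕ.* suc t)
      a = 2 ℕ.* (n ℕ.* (δ ℕ.+ t ℕ.* h))
      b = 2 ℕ.* (m ℕ.+ m)

      z : ℤ
      z = + 2 ℤ.* (+ n ℤ.* (+ δ ℤ.+ + t ℤ.* + h) ℤ.- + 2 ℤ.* + m)

      instance
        D≢0 : NonZero D
        D≢0 = m*n≢0 h (t ℕ.* suc t) {{_}} {{m*n≢0 t (suc t)}}

      z≡a-b : z ≡ + a ℤ.- + b
      z≡a-b = begin
        + 2 ℤ.* (+ n ℤ.* (+ δ ℤ.+ + t ℤ.* + h) ℤ.- + 2 ℤ.* + m)
          ≡⟨ solve 2 (λ x m → con (+ 2) :* (x :- con (+ 2) :* m)
                := con (+ 2) :* x :- con (+ 2) :* (m :+ m)) refl (+ n ℤ.* (+ δ ℤ.+ + t ℤ.* + h)) (+ m) ⟩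
        + 2 ℤ.* (+ n ℤ.* (+ δ ℤ.+ + t ℤ.* + h)) ℤ.- + 2 ℤ.* (+ m ℤ.+ + m)
          ≡⟨ cong₂ ℤ._-_ (trans (cong (+ 2 ℤ.*_) (trans (cong (λ y → + n ℤ.* (+ δ ℤ.+ y)) (sym (ℤ.pos-* t h))) (sym (ℤ.pos-* n (δ ℕ.+ t ℕ.* h)))))
                                (sym (ℤ.pos-* 2 (n ℕ.* (δ ℕ.+ t ℕ.* h)))))
                         (sym (ℤ.pos-* 2 (m ℕ.+ m))) ⟩
        + a ℤ.- + b ∎
        where
        open ≡-Reasoning
        open ℤ.+-*-Solver

      rD≡ : + r ℤ.* + D ≡ + (h ℕ.* (r ℕ.* (t ℕ.* suc t)))
      rD≡ = trans (sym (ℤ.pos-* r D)) (cong +_ (solve 3 (λ r h T → r :* (h :* T)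
            := h :* (r :* T)) refl r h (t ℕ.* suc t)))
        where open ℕ.+-*-Solver

    -- A bound by an integer holds for the ceiling as soon as it holds for `f_t`; the rest clears
    -- the denominator. The converse below serves to refute the bound `s′`.
    ceiling-f≤⁺ : 2 ℕ.* (n ℕ.* (δ ℕ.+ t ℕ.* suc k)) ℕ.≤ 2 ℕ.* (m ℕ.+ m) ℕ.+ suc k ℕ.* (r ℕ.* (t ℕ.* suc t)) →
                  ceiling (f t n m δ k) ℤ.≤ + r
    ceiling-f≤⁺ le = ceiling-≤⁺ (z / D) (+ r) (/-≤⁺ z D (+ r) 1 (begin
      z ℤ.* + 1              ≡⟨ trans (ℤ.*-identityʳ z) z≡a-b ⟩
      + a ℤ.- + b            ≤⟨ ℤ.+-monoˡ-≤ (ℤ.- + b) (ℤ.+≤+ le) ⟩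
      + b ℤ.+ + c ℤ.- + b    ≡⟨ solve 2 (λ b c → b :+ c :- b := c) refl (+ b) (+ c) ⟩
      + c                    ≡⟨ rD≡ ⟨
      + r ℤ.* + D            ∎))
      where
      open ℤ.≤-Reasoning
      open ℤ.+-*-Solver
      c = h ℕ.* (r ℕ.* (t ℕ.* suc t))

    ceiling-f≤⁻ : ceiling (f t n m δ k) ℤ.≤ + r →
                  2 ℕ.* (n ℕ.* (δ ℕ.+ t ℕ.* suc k)) ℕ.≤ 2 ℕ.* (m ℕ.+ m) ℕ.+ suc k ℕ.* (r ℕ.* (t ℕ.* suc t))
    ceiling-f≤⁻ le = ℤ.drop‿+≤+ (begin
      + a                    ≡⟨ solve 2 (λ a b → a := b :+ (a :- b)) refl (+ a) (+ b) ⟩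
      + b ℤ.+ (+ a ℤ.- + b)  ≡⟨ cong (λ y → + b ℤ.+ y) (trans (ℤ.*-identityʳ z) z≡a-b) ⟨
      + b ℤ.+ z ℤ.* + 1      ≤⟨ ℤ.+-monoʳ-≤ (+ b) (/-≤⁻ z D (+ r) 1 (ceiling-≤⁻ (z / D) (+ r) le)) ⟩
      + b ℤ.+ + r ℤ.* + D    ≡⟨ cong (λ y → + b ℤ.+ y) rD≡ ⟩
      + b ℤ.+ + c            ∎)
      where
      open ℤ.≤-Reasoning
      open ℤ.+-*-Solver
      c = h ℕ.* (r ℕ.* (t ℕ.* suc t))

-- Matching the two bounds

open import Defs
open import Data.Integer as ℤ using (ℤ; +_)
open import Data.Nat as ℕ using (ℕ; suc; NonZero)
open import Data.Nat.Properties using (m*n≢0)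
open import Data.Product using (Σ; ∃; _×_)
open import Data.Rational using (ℚ; _+_; _*_; _-_; _/_; _≤_; _≥_; _⊔_; ceiling)
open import Relation.Binary.PropositionalEquality using (_≡_)
import Data.Integer.Properties as ℤ
import Data.Nat.Properties as ℕ
open import Data.Product using (_,_; proj₁; proj₂)
open import Relation.Binary.PropositionalEquality using (refl; subst)
open import Relation.Nullary using (¬_)

theorem13 :
  (n m δ k : ℕ) .{{_ : NonZero n}} .{{_ : NonZero δ}} →
  let h = suc k
      d = + (2 ℕ.* m) / n
      x = (d - fromℕ δ) /ℕ h
  in
  d ≥ fromℕ δ →
  fromℕ n ≥ (_/ℕ_ (square (fromℕ 2 * d + fromℕ 5 * fromℕ h + fromℕ 1)) (4 ℕ.* δ) {{m*n≢0 4 δ}})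
            ⊔ square (fromℕ 2 * x + fromℕ 3) →
  ∃ λ (s : ℕ) →
    IsLeast ℕ._≤_
      (λ r → Σ (Graph n) λ G → edgeCount G ≡ m × minDegree G ≡ δ × sp G k ≡ r)
      s
    × IsGreatest ℤ._≤_
      (λ c → Σ ℕ λ t → Σ (NonZero t) λ t≢0 → ceiling (f t n m δ k {{t≢0}}) ≡ c)
      (+ s)
theorem13 n m δ k δ≤d large =
  s , ((G , edges≡m , min≡δ , sp≡s) , λ { _ (G′ , e , μ , refl) → s≤sp G′ e μ })
    , ((t , t≢0 , ℤ.≤-antisym (ceiling≤s t t≢0) s≤ceiling) , λ { _ (u , u≢0 , refl) → ceiling≤s u u≢0 })
  where
  open Combinatorics
  open Arithmetic

  open Hypotheses n m δ (suc k) using (δn≤2m; square≤4δn; square≤n)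

  N : ℕ
  N = 2 ℕ.* m ℕ.∸ δ ℕ.* n

  N+δn≡2m : N ℕ.+ δ ℕ.* n ≡ 2 ℕ.* m
  N+δn≡2m = ℕ.m∸n+n≡m (δn≤2m δ≤d)

  open Construction n m δ k N N+δn≡2m
    (square≤4δn large)
    (square≤n large N N+δn≡2m)
    using (s; s′; t; t≢0; t-witness; optimal)

  ceiling≤sp : ∀ G → edgeCount G ≡ m → minDegree G ≡ δ → ∀ t (t≢0 : NonZero t) →
               ceiling (f t n m δ k {{t≢0}}) ℤ.≤ + sp G k
  ceiling≤sp G refl refl t t≢0 = ceiling-f≤⁺ n m δ k t (sp G k) {{t≢0}} (LowerBound.sp-lower G k δ
    (λ v → subst (δ ℕ.≤_) (degree≡deg G v) (minDegree≤degree G v)) t)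

  ceiling≰s′ : ¬ ceiling (f t n m δ k {{t≢0}}) ℤ.≤ + s′
  ceiling≰s′ le = ℕ.<⇒≱ t-witness (ceiling-f≤⁻ n m δ k t s′ {{t≢0}} le)

  -- Rounding up closes the gap: an integer that is not at most `s′` is at least `suc s′`, which is
  -- `s`.
  s≤ceiling : + s ℤ.≤ ceiling (f t n m δ k {{t≢0}})
  s≤ceiling = ℤ.i<j⇒suc[i]≤j (ℤ.≰⇒> ceiling≰s′)

  s≤sp : ∀ G → edgeCount G ≡ m → minDegree G ≡ δ → s ℕ.≤ sp G k
  s≤sp G e μ = ℤ.drop‿+≤+ (ℤ.≤-trans s≤ceiling (ceiling≤sp G e μ t t≢0))

  G : Graph n
  G = proj₁ optimal

  edges≡m : edgeCount G ≡ m
  edges≡m = proj₁ (proj₂ optimal)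

  min≡δ : minDegree G ≡ δ
  min≡δ = proj₁ (proj₂ (proj₂ optimal))

  sp≡s : sp G k ≡ s
  sp≡s = ℕ.≤-antisym (proj₂ (proj₂ (proj₂ optimal))) (s≤sp G edges≡m min≡δ)

  -- The optimal graph alone bounds the ceilings for all `u`, as its `sp` equals `s`.
  ceiling≤s : ∀ u (u≢0 : NonZero u) → ceiling (f u n m δ k {{u≢0}}) ℤ.≤ + s
  ceiling≤s u u≢0 = subst (λ r → ceiling (f u n m δ k {{u≢0}}) ℤ.≤ + r) sp≡s (ceiling≤sp G edges≡m min≡δ u u≢0)
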